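{- Let $n\ge 8$ be an integer and define $g(n)=2n-\lfloor n/4\rfloor$ if $n\equiv 0$ or $3 \pmod 4$, and $g(n)=2n+1-\lfloor n/4\rfloor$ otherwise. Then the minimum number of edges of a $2$-connected locally nonforesty graph of order $n$ is $g(n)$; that is, every $2$-connected locally nonforesty graph of order $n$ has at least $g(n)$ edges, and there exists a $2$-connected locally nonforesty graph of order $n$ with exactly $g(n)$ edges.
   Context: All graphs are finite and simple. The order of a graph is its number of vertices and its size is its number of edges. For a vertex $v$ of a graph $G$, the local subgraph at $v$ is the subgraph of $G$ induced by the (open) neighborhood $N(v)$ of $v$. A graph $G$ is called locally nonforesty if every local subgraph of $G$ contains a cycle (equivalently, every vertex of $G$ is the hub of a wheel in $G$). -}

module Defs where

open import Data.Nat using (ℕ; zero; suc; _+_; _*_; _∸_; _≤_; _<ᵇ_)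
open import Data.Nat.DivMod using (_/_; _%_)
open import Data.Bool using (Bool; true; false; if_then_else_; _∧_)
open import Data.Fin using (Fin; toℕ; inject₁; fromℕ) renaming (zero to fzero; suc to fsuc)
open import Data.List using (List; map; allFin)
open import Data.Nat.ListAction using (sum)
open import Data.Product using (Σ; _×_)
open import Data.Unit using (⊤)
open import Relation.Binary.PropositionalEquality using (_≡_; _≢_)
open import Function.Definitions using (Injective)

record Graph (n : ℕ) : Set where
  field
    adj    : Fin n → Fin n → Bool
    adj-sym    : ∀ i j → adj i j ≡ adj j i
    adj-irrefl : ∀ i → adj i i ≡ false
open Graph public

Edge : ∀ {n} → Graph n → Fin n → Fin n → Set
Edge G i j = adj G i j ≡ true

size : ∀ {n} → Graph n → ℕ
size {n} G = sum (map (λ i → sum (map (λ j → if (toℕ i <ᵇ toℕ j) ∧ adj G i j then 1 else 0) (allFin n))) (allFin n))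

data Walk {n : ℕ} (G : Graph n) (P : Fin n → Set) : Fin n → Fin n → Set where
  here : ∀ {u} → P u → Walk G P u u
  step : ∀ {u v w} → P u → Edge G u v → Walk G P v w → Walk G P u w

Connected : ∀ {n} → Graph n → Set
Connected G = ∀ u v → Walk G (λ _ → ⊤) u v

ConnectedWithout : ∀ {n} → Graph n → Fin n → Set
ConnectedWithout G x = ∀ u v → u ≢ x → v ≢ x → Walk G (λ w → w ≢ x) u v

TwoConnected : ∀ {n} → Graph n → Set
TwoConnected {n} G = (3 ≤ n) × Connected G × (∀ x → ConnectedWithout G x)

-- a cycle of length m+3 in the subgraph of G induced by N(v):
-- distinct vertices c 0, ..., c (m+2), all adjacent to v,
-- consecutive ones adjacent, and the last adjacent to the first.
LocalCycle : ∀ {n} → Graph n → Fin n → Set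
LocalCycle {n} G v =
  Σ ℕ λ m → Σ (Fin (suc (suc (suc m))) → Fin n) λ c →
    Injective _≡_ _≡_ c
    × (∀ i → Edge G v (c i))
    × (∀ (i : Fin (suc (suc m))) → Edge G (c (inject₁ i)) (c (fsuc i)))
    × Edge G (c (fromℕ (suc (suc m)))) (c fzero)

LocallyNonforesty : ∀ {n} → Graph n → Set
LocallyNonforesty G = ∀ v → LocalCycle G v

g : ℕ → ℕ
g n with n % 4
... | 0 = 2 * n ∸ n / 4
... | 3 = 2 * n ∸ n / 4
... | _ = 2 * n + 1 ∸ n / 4

{-# OPTIONS --safe #-}

-- Lower bound, by discharging. A vertex v of degree 3 lies in the K4 N[v], of which at least two
-- vertices have larger degree because there is no cut vertex. Give v the charge deg v − 7/2 and let
-- every vertex of larger degree pass 1/4 to each of its neighbours of degree 3. No final charge is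
-- negative, so 8 |E| = 14 n + S with S ≥ 0. By parity this already is the bound, except that S = 2
-- (for n ≡ 1 mod 4) and S = 4 (for n ≡ 2) must be excluded; in fact S ≤ 4 forces S = 0: a vertex
-- with positive charge then either is accompanied by too many others or has a closed neighbourhood
-- that is a component of order at most 6.
--
-- Extremal graphs: k copies of K4 arranged in a ring have order 4k and size 7k. The other residues
-- are obtained by enlarging one K4 to K5 minus an edge, or to two K4 sharing an edge or a vertex.
module Submission where

open import Defs
open import Data.Bool using (Bool; true; false; T; _∧_; if_then_else_)
open import Data.Bool.Properties using (∧-comm) renaming (_≟_ to _≟ᵇ_)
open import Data.Empty using (⊥; ⊥-elim)
open import Data.Fin using (Fin; toℕ; fromℕ; inject₁; _↑ˡ_; _↑ʳ_) renaming (zero to fzero; suc to fsuc)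
open import Data.Fin.Properties using (_≟_; any?; all?; toℕ-injective; ↑ˡ-injective)
open import Data.List using (List; []; _∷_; length; map; allFin; tabulate)
open import Data.List.Membership.Propositional using (_∈_)
open import Data.List.Properties using (map-tabulate; map-cong-local)
open import Data.List.Relation.Unary.All as All using (All; []; _∷_)
open import Data.List.Relation.Unary.All.Properties using (¬Any⇒All¬)
open import Data.List.Relation.Unary.AllPairs using ([]; _∷_)
open import Data.List.Relation.Unary.Any as Any using (here; there)
open import Data.List.Relation.Unary.Unique.Propositional using (Unique)
open import Data.Nat using (ℕ; zero; suc; _+_; _*_; _∸_; _≤_; _<_; _≡ᵇ_; _<ᵇ_; z≤n; s≤s; s≤s⁻¹)
open import Data.Nat.Divisibility using (_∣_; _∣?_; divides; ∣m∣n⇒∣m+n; ∣m+n∣m⇒∣n; _∣0; m∣m*n)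
open import Data.Nat.DivMod using (_/_; _%_; m≡m%n+[m/n]*n; m%n<n; /-monoˡ-≤)
import Data.Nat.ListAction as ListAction
open import Data.Nat.Properties renaming (_≟_ to _≟ⁿ_)
open import Data.Nat.Tactic.RingSolver using (solve-∀)
open import Data.Product using (Σ; ∃; _×_; _,_; proj₁; proj₂)
open import Data.Sum as Sum using (_⊎_; inj₁; inj₂)
open import Data.Unit using (⊤; tt)
open import Data.Vec using (lookup; []; _∷_)
open import Function using (_∘_; id)
open import Relation.Binary.PropositionalEquality
open import Relation.Nullary using (¬_; Dec; yes; no; does; contradiction)
open import Relation.Nullary.Decidable
  using (¬?; _×-dec_; _⊎-dec_; _→-dec_; decidable-stable; from-no; from-yes; dec-true)
open import Algebra.Properties.Semiring.Sum +-*-semiring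
  using (sum; sum-syntax; ∑-distrib-+; ∑-comm; sum-cong-≗; sum-replicate-zero; *-distribˡ-sum)

-- Sums and counting over Fin n

𝟙 : Bool → ℕ
𝟙 b = if b then 1 else 0

opaque
  count : ∀ {n} → (Fin n → Bool) → ℕ
  count f = ∑[ i < _ ] 𝟙 (f i)

  count-∑ : ∀ {n} (f : Fin n → Bool) → count f ≡ ∑[ i < n ] 𝟙 (f i)
  count-∑ f = refl

∑-const : ∀ n c → ∑[ i < n ] c ≡ n * c
∑-const zero    c = refl
∑-const (suc n) c = cong (c +_) (∑-const n c)

∑-zero : ∀ {n} {f : Fin n → ℕ} → (∀ i → f i ≡ 0) → sum f ≡ 0
∑-zero {n} p = trans (sum-cong-≗ p) (sum-replicate-zero n)

∑-∣ : ∀ {n d} {f : Fin n → ℕ} → (∀ i → d ∣ f i) → d ∣ sum f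
∑-∣ {zero}  {d} p = d ∣0
∑-∣ {suc n}     p = ∣m∣n⇒∣m+n (p fzero) (∑-∣ (p ∘ fsuc))

sum-allFin : ∀ {n} (f : Fin n → ℕ) → ListAction.sum (map f (allFin n)) ≡ sum f
sum-allFin f = trans (cong ListAction.sum (map-tabulate id f)) (go f)
  where
  go : ∀ {n} (f : Fin n → ℕ) → ListAction.sum (tabulate f) ≡ sum f
  go {zero}  f = refl
  go {suc n} f = cong (f fzero +_) (go (f ∘ fsuc))

infixl 8 _∖_
_∖_ : ∀ {n} → (Fin n → ℕ) → Fin n → Fin n → ℕ
(f ∖ x) y = if does (x ≟ y) then 0 else f y

∑-split : ∀ {n} (f : Fin n → ℕ) x → sum f ≡ f x + sum (f ∖ x)
∑-split f fzero    = refl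
∑-split f (fsuc x) = begin
  f fzero + sum (f ∘ fsuc)                         ≡⟨ cong (f fzero +_) (∑-split (f ∘ fsuc) x) ⟩
  f fzero + (f (fsuc x) + sum ((f ∘ fsuc) ∖ x))    ≡⟨ swap (f fzero) (f (fsuc x)) _ ⟩
  f (fsuc x) + (f fzero + sum ((f ∘ fsuc) ∖ x))    ∎
  where
  open ≡-Reasoning
  swap : ∀ a b c → a + (b + c) ≡ b + (a + c)
  swap = solve-∀

∖-other : ∀ {n} (f : Fin n → ℕ) {x y} → x ≢ y → (f ∖ x) y ≡ f y
∖-other f {x} {y} x≢y with x ≟ y
... | yes x≡y = contradiction x≡y x≢y
... | no  _   = refl

∖-∣ : ∀ {n d} (f : Fin n → ℕ) x → (∀ y → x ≢ y → d ∣ f y) → ∀ y → d ∣ (f ∖ x) y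
∖-∣ {d = d} f x p y with x ≟ y
... | yes _   = d ∣0
... | no  x≢y = p y x≢y

-- Splitting off the head `x` leaves `f ∖ x`, which agrees with `f` on the remaining entries because
-- they differ from `x`; the induction therefore runs on `f ∖ x`.
∑-distinct : ∀ {n} (f : Fin n → ℕ) {xs} → Unique xs → ListAction.sum (map f xs) ≤ sum f
∑-distinct f []                 = z≤n
∑-distinct f {x ∷ xs} (x∉ ∷ ux) = begin
  f x + ListAction.sum (map f xs)        ≡⟨ cong (λ ys → f x + ListAction.sum ys)
                                              (map-cong-local (All.map (sym ∘ ∖-other f) x∉)) ⟩
  f x + ListAction.sum (map (f ∖ x) xs)  ≤⟨ +-monoʳ-≤ (f x) (∑-distinct (f ∖ x) ux) ⟩
  f x + sum (f ∖ x)                      ≡⟨ ∑-split f x ⟨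
  sum f                                  ∎
  where open ≤-Reasoning

delete : ∀ {n} → (Fin n → Bool) → Fin n → Fin n → Bool
delete f x y = if does (x ≟ y) then false else f y

delete⁻ : ∀ {n} (f : Fin n → Bool) x y → delete f x y ≡ true → f y ≡ true × y ≢ x
delete⁻ f x y q with x ≟ y
... | no x≢y = q , x≢y ∘ sym

count-delete : ∀ {n} (f : Fin n → Bool) x → count f ≤ suc (count (delete f x))
count-delete f x = begin
  count f                     ≡⟨ count-∑ f ⟩
  sum (𝟙 ∘ f)                 ≡⟨ ∑-split (𝟙 ∘ f) x ⟩
  𝟙 (f x) + sum (𝟙 ∘ f ∖ x)   ≤⟨ +-mono-≤ (𝟙≤1 (f x)) (≤-reflexive (sum-cong-≗ pointwise)) ⟩
  1 + sum (𝟙 ∘ delete f x)    ≡⟨ cong suc (count-∑ (delete f x)) ⟨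
  1 + count (delete f x)      ∎
  where
  open ≤-Reasoning
  pointwise : ∀ y → (𝟙 ∘ f ∖ x) y ≡ 𝟙 (delete f x y)
  pointwise y with does (x ≟ y)
  ... | true  = refl
  ... | false = refl
  𝟙≤1 : ∀ b → 𝟙 b ≤ 1
  𝟙≤1 true  = ≤-refl
  𝟙≤1 false = z≤n

opaque
  ∑-positive : ∀ {n} (f : Fin n → ℕ) → 0 < sum f → ∃ λ x → 0 < f x
  ∑-positive {suc n} f p with f fzero in eq
  ... | suc _ = fzero , subst (0 <_) (sym eq) (s≤s z≤n)
  ... | zero with ∑-positive (f ∘ fsuc) p
  ...   | x , q = fsuc x , q

  count-distinct : ∀ {n} (f : Fin n → Bool) {xs} → Unique xs → All (λ x → f x ≡ true) xs →
                   length xs ≤ count f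
  count-distinct f {xs} ux fxs = subst₂ _≤_ (go fxs) (sym (count-∑ f)) (∑-distinct (𝟙 ∘ f) ux)
    where
    go : ∀ {xs} → All (λ x → f x ≡ true) xs → ListAction.sum (map (𝟙 ∘ f) xs) ≡ length xs
    go []       = refl
    go (p ∷ ps) = cong₂ _+_ (cong 𝟙 p) (go ps)

  -- Pigeonhole: deleting a listed element from `f` lowers the count by at most one, so something is
  -- left after the whole list is deleted.
  fresh : ∀ {n} (f : Fin n → Bool) xs → length xs < count f → ∃ λ y → f y ≡ true × All (y ≢_) xs
  fresh f [] p with ∑-positive (𝟙 ∘ f) (subst (0 <_) (count-∑ f) p)
  ... | y , q with f y in eq
  ...   | true = y , eq , []
  fresh f (x ∷ xs) p =
    let y , q , y∉ = fresh (delete f x) xs (s≤s⁻¹ (≤-trans p (count-delete f x)))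
        fy , y≢x = delete⁻ f x y q
    in y , fy , y≢x ∷ y∉

  -- Otherwise `z ∷ xs` would be a longer list of distinct elements than the count allows. This
  -- turns a known degree into an explicit list of all neighbours.
  exhausted : ∀ {n} (f : Fin n → Bool) {xs} → Unique xs → All (λ x → f x ≡ true) xs →
              count f ≤ length xs → ∀ {z} → f z ≡ true → z ∈ xs
  exhausted f {xs} ux fxs le {z} fz with Any.any? (z ≟_) xs
  ... | yes z∈ = z∈
  ... | no  z∉ = contradiction (count-distinct f (¬Any⇒All¬ xs z∉ ∷ ux) (fz ∷ fxs)) (≤⇒≯ le)

-- Invariants along walks, degrees and the handshake identity.

walk-invariant : ∀ {n} {G : Graph n} {P Q : Fin n → Set} →
                 (∀ {u z} → Q u → P z → Edge G u z → Q z) →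
                 ∀ {u v} → Walk G P u v → Q u → Q v
walk-invariant pres (here _)                q = q
walk-invariant pres (step _ e (here p))     q = pres q p e
walk-invariant pres (step _ e w@(step p _ _)) q = walk-invariant pres w (pres q p e)

degree : ∀ {n} → Graph n → Fin n → ℕ
degree G v = count (adj G v)

upper : ∀ {n} → Graph n → Fin n → Fin n → ℕ
upper G i j = if (toℕ i <ᵇ toℕ j) ∧ adj G i j then 1 else 0

size-∑ : ∀ {n} (G : Graph n) → size G ≡ ∑[ i < n ] ∑[ j < n ] upper G i j
size-∑ {n} G = trans (sum-allFin {n} _) (sum-cong-≗ (λ i → sum-allFin (upper G i)))

-- Each adjacency is counted by exactly one of `upper G i j` and `upper G j i`, and interchanging
-- the summations shows that both halves equal `size G`.
handshake : ∀ {n} (G : Graph n) → ∑[ v < n ] degree G v ≡ 2 * size G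
handshake {n} G = begin
  ∑[ i < n ] degree G i
    ≡⟨ sum-cong-≗ (λ i → trans (trans (count-∑ (adj G i)) (sum-cong-≗ (both i))) (∑-distrib-+ (upper G i) (λ j → upper G j i))) ⟩
  ∑[ i < n ] (∑[ j < n ] upper G i j + ∑[ j < n ] upper G j i)
    ≡⟨ ∑-distrib-+ (λ i → ∑[ j < n ] upper G i j) _ ⟩
  ∑[ i < n ] ∑[ j < n ] upper G i j + ∑[ i < n ] ∑[ j < n ] upper G j i
    ≡⟨ cong (∑[ i < n ] ∑[ j < n ] upper G i j +_) (∑-comm (λ i j → upper G j i)) ⟩
  ∑[ i < n ] ∑[ j < n ] upper G i j + ∑[ i < n ] ∑[ j < n ] upper G i j
    ≡⟨ cong₂ _+_ (size-∑ G) (trans (+-identityʳ _) (size-∑ G)) ⟨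
  2 * size G ∎
  where
  open ≡-Reasoning
  both : ∀ i j → 𝟙 (adj G i j) ≡ upper G i j + upper G j i
  both i j with toℕ i <ᵇ toℕ j in p | toℕ j <ᵇ toℕ i in q
  ... | true | true =
    contradiction (<ᵇ⇒< (toℕ i) (toℕ j) (subst T (sym p) _))
                  (<⇒≯ (<ᵇ⇒< (toℕ j) (toℕ i) (subst T (sym q) _)))
  ... | true  | false = sym (+-identityʳ _)
  ... | false | true  = cong 𝟙 (adj-sym G i j)
  ... | false | false = cong 𝟙 (trans (cong (adj G i) (sym i≡j)) (adj-irrefl G i))
    where
    ¬< : ∀ {a b} → (a <ᵇ b) ≡ false → ¬ a < b
    ¬< eq lt = subst T eq (<⇒<ᵇ lt)
    i≡j : i ≡ j
    i≡j = toℕ-injective (≤-antisym (≮⇒≥ (¬< q)) (≮⇒≥ (¬< p)))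

opaque
  choose : ∀ {n} (f : Fin n → Bool) k → k ≤ count f →
           ∃ λ xs → length xs ≡ k × Unique xs × All (λ x → f x ≡ true) xs
  choose f zero    _ = [] , refl , [] , []
  choose f (suc k) p =
    let xs , len , ux , fxs = choose f k (<⇒≤ p)
        y , fy , y∉ = fresh f xs (subst (_< count f) (sym len) p)
    in y ∷ xs , cong suc len , y∉ ∷ ux , fy ∷ fxs

-- Discharging

module LowerBound {n : ℕ} (G : Graph n) (8≤n : 8 ≤ n) (connected : Connected G)
                  (noCut : ∀ x → ConnectedWithout G x) (nonforesty : LocallyNonforesty G) where

  infix 4 _~_
  _~_ : Fin n → Fin n → Set
  u ~ v = Edge G u v

  deg : Fin n → ℕ
  deg = degree G

  ~-sym : ∀ {u v} → u ~ v → v ~ u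
  ~-sym {u} {v} e = trans (adj-sym G v u) e

  ~⇒≢ : ∀ {u v} → u ~ v → u ≢ v
  ~⇒≢ {u} e refl with trans (sym e) (adj-irrefl G u)
  ... | ()

  cubic : Fin n → Bool
  cubic v = deg v ≡ᵇ 3

  cubic⇒deg≡3 : ∀ {v} → cubic v ≡ true → deg v ≡ 3
  cubic⇒deg≡3 {v} p = ≡ᵇ⇒≡ (deg v) 3 (subst T (sym p) _)

  cubic≢ : ∀ {u v} → cubic u ≡ true → cubic v ≡ false → u ≢ v
  cubic≢ p q refl with trans (sym p) q
  ... | ()

  -- The first three vertices of the cycle in `N(v)` are distinct neighbours of `v`.
  3≤deg : ∀ v → 3 ≤ deg v
  3≤deg v with nonforesty v
  ... | m , c , inj , hub , _ = count-distinct (adj G v)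
    {c fzero ∷ c (fsuc fzero) ∷ c (fsuc (fsuc fzero)) ∷ []}
    (((λ ()) ∘ inj ∷ (λ ()) ∘ inj ∷ []) ∷ ((λ ()) ∘ inj ∷ []) ∷ [] ∷ [])
    (hub _ ∷ hub _ ∷ hub _ ∷ [])

  4≤deg : ∀ {v} → cubic v ≡ false → 4 ≤ deg v
  4≤deg {v} p = ≤∧≢⇒< (3≤deg v) (λ eq → subst T p (≡⇒≡ᵇ (deg v) 3 (sym eq)))

  -- The cycle in N(v) uses all three neighbours, so it is a triangle.
  cubic-clique : ∀ {v u z} → cubic v ≡ true → v ~ u → v ~ z → u ≢ z → u ~ z
  cubic-clique {v} {u} {z} cv vu vz u≢z with nonforesty v
  ... | suc m , c , inj , hub , _ = contradiction
    (subst (4 ≤_) (cubic⇒deg≡3 cv) (count-distinct (adj G v)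
      {c fzero ∷ c (fsuc fzero) ∷ c (fsuc (fsuc fzero)) ∷ c (fsuc (fsuc (fsuc fzero))) ∷ []}
      (((λ ()) ∘ inj ∷ (λ ()) ∘ inj ∷ (λ ()) ∘ inj ∷ []) ∷ ((λ ()) ∘ inj ∷ (λ ()) ∘ inj ∷ []) ∷
       ((λ ()) ∘ inj ∷ []) ∷ [] ∷ [])
      (hub _ ∷ hub _ ∷ hub _ ∷ hub _ ∷ [])))
    λ { (s≤s (s≤s (s≤s ()))) }
  ... | zero , c , inj , hub , path , close = go (in-cycle vu) (in-cycle vz)
    where
    cs : List (Fin n)
    cs = c fzero ∷ c (fsuc fzero) ∷ c (fsuc (fsuc fzero)) ∷ []
    in-cycle : ∀ {y} → v ~ y → y ∈ cs
    in-cycle = exhausted (adj G v)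
      (((λ ()) ∘ inj ∷ (λ ()) ∘ inj ∷ []) ∷ ((λ ()) ∘ inj ∷ []) ∷ [] ∷ [])
      (hub _ ∷ hub _ ∷ hub _ ∷ []) (≤-reflexive (cubic⇒deg≡3 cv))
    go : u ∈ cs → z ∈ cs → u ~ z
    go (here refl)                 (here refl)                 = contradiction refl u≢z
    go (here refl)                 (there (here refl))         = path fzero
    go (here refl)                 (there (there (here refl))) = ~-sym close
    go (there (here refl))         (here refl)                 = ~-sym (path fzero)
    go (there (here refl))         (there (here refl))         = contradiction refl u≢z
    go (there (here refl))         (there (there (here refl))) = path (fsuc fzero)
    go (there (there (here refl))) (here refl)                 = close
    go (there (there (here refl))) (there (here refl))         = ~-sym (path (fsuc fzero))
    go (there (there (here refl))) (there (there (here refl))) = contradiction refl u≢z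

  -- Neighbours of degree 3 and neighbours of larger degree.

  nbr : Bool → Fin n → Fin n → Bool
  nbr b v u = adj G v u ∧ does (cubic u ≟ᵇ b)

  nbr⁺ : ∀ {b v u} → v ~ u → cubic u ≡ b → nbr b v u ≡ true
  nbr⁺ {true}  e p rewrite e | p = refl
  nbr⁺ {false} e p rewrite e | p = refl

  nbr⁻ : ∀ {b v u} → nbr b v u ≡ true → v ~ u × cubic u ≡ b
  nbr⁻ {b} {v} {u} p with adj G v u | cubic u ≟ᵇ b
  ... | true | yes q = refl , q

  -- `t` counts the neighbours of degree 3; those counted by `h` all have degree at least 4, by
  -- `4≤deg`.
  t h : Fin n → ℕ
  t v = count (nbr true v)
  h v = count (nbr false v)

  t+h≡deg : ∀ v → t v + h v ≡ deg v
  t+h≡deg v = begin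
    t v + h v                                               ≡⟨ cong₂ _+_ (count-∑ (nbr true v)) (count-∑ (nbr false v)) ⟩
    sum (𝟙 ∘ nbr true v) + sum (𝟙 ∘ nbr false v)            ≡⟨ ∑-distrib-+ (𝟙 ∘ nbr true v) (𝟙 ∘ nbr false v) ⟨
    ∑[ u < n ] (𝟙 (nbr true v u) + 𝟙 (nbr false v u))       ≡⟨ sum-cong-≗ split ⟩
    ∑[ u < n ] 𝟙 (adj G v u)                                ≡⟨ count-∑ (adj G v) ⟨
    deg v                                                   ∎
    where
    open ≡-Reasoning
    split : ∀ u → 𝟙 (nbr true v u) + 𝟙 (nbr false v u) ≡ 𝟙 (adj G v u)
    split u with adj G v u | cubic u
    ... | true  | true  = refl
    ... | true  | false = refl
    ... | false | _     = refl

  another : ∀ b v xs → length xs < count (nbr b v) →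
            ∃ λ u → v ~ u × cubic u ≡ b × All (u ≢_) xs
  another b v xs lt = let u , p , u∉ = fresh (nbr b v) xs lt
                          e , q = nbr⁻ p in u , e , q , u∉

  -- The form of `cubic-clique` used in closure arguments: `N(v)` is contained in `N[w]` for every
  -- neighbour `w` of a cubic `v`.
  cubic-neighbourhood : ∀ {v w z} → cubic v ≡ true → v ~ w → v ~ z → z ≡ w ⊎ w ~ z
  cubic-neighbourhood {v} {w} {z} cv vw vz with w ≟ z
  ... | yes w≡z = inj₁ (sym w≡z)
  ... | no  w≢z = inj₂ (cubic-clique cv vw vz w≢z)

  count-all : count {n} (λ _ → true) ≡ n
  count-all = trans (count-∑ _) (trans (∑-const n 1) (*-identityʳ n))

  -- If v, a, b are cubic and pairwise adjacent, the fourth vertex x of their K4 is a cut vertex.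
  cubic-path-absurd : ∀ {v a b x} → cubic v ≡ true → cubic a ≡ true → cubic b ≡ true →
                      v ~ a → v ~ b → v ~ x → Unique (x ∷ b ∷ a ∷ []) → ⊥
  cubic-path-absurd {v} {a} {b} {x} cv ca cb va vb vx uxs =
    -- As `n ≥ 8`, some vertex lies outside the four vertices of the K4.
    outside (fresh (λ _ → true) (x ∷ b ∷ a ∷ v ∷ []) (subst (5 ≤_) (sym count-all) (≤-trans (m≤m+n 5 3) 8≤n)))
    where
    inside : ∀ {z} → z ≢ x → v ~ z → z ∈ v ∷ a ∷ b ∷ []
    inside z≢x vz with exhausted (adj G v) uxs (vx ∷ vb ∷ va ∷ []) (≤-reflexive (cubic⇒deg≡3 cv)) vz
    ... | here refl                 = contradiction refl z≢x
    ... | there (here refl)         = there (there (here refl))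
    ... | there (there (here refl)) = there (here refl)
    around : ∀ {u z} → cubic u ≡ true → v ~ u → z ≢ x → u ~ z → z ∈ v ∷ a ∷ b ∷ []
    around cu vu z≢x uz with cubic-neighbourhood cu (~-sym vu) uz
    ... | inj₁ z≡v = here z≡v
    ... | inj₂ vz  = inside z≢x vz
    closed : ∀ {u z} → u ∈ v ∷ a ∷ b ∷ [] → z ≢ x → u ~ z → z ∈ v ∷ a ∷ b ∷ []
    closed (here refl)                 z≢x e = inside z≢x e
    closed (there (here refl))         z≢x e = around ca va z≢x e
    closed (there (there (here refl))) z≢x e = around cb vb z≢x e
    outside : (∃ λ y → true ≡ true × All (y ≢_) (x ∷ b ∷ a ∷ v ∷ [])) → ⊥
    outside (y , _ , y≢x ∷ y≢b ∷ y≢a ∷ y≢v ∷ [])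
      -- The set of `v`, `a`, `b` is closed under steps that avoid `x`, yet `noCut x` provides such
      -- a walk from `v` to `y`.
      with walk-invariant closed (noCut x v y (~⇒≢ vx) y≢x) (here refl)
    ... | here p                 = y≢v p
    ... | there (here p)         = y≢a p
    ... | there (there (here p)) = y≢b p

  -- Two cubic neighbours together with the third neighbour of `v` form the configuration excluded
  -- by `cubic-path-absurd`.
  cubic⇒t≤1 : ∀ {v} → cubic v ≡ true → t v ≤ 1
  cubic⇒t≤1 {v} cv = ≮⇒≥ (λ 2≤t → third (choose (nbr true v) 2 2≤t))
    where
    third : ¬ (∃ λ xs → length xs ≡ 2 × Unique xs × All (λ x → nbr true v x ≡ true) xs)
    third (b ∷ a ∷ [] , _ , u , pb ∷ pa ∷ []) =
      let vb , cb = nbr⁻ pb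
          va , ca = nbr⁻ pa
          x , vx , x∉ = fresh (adj G v) (b ∷ a ∷ []) (≤-reflexive (sym (cubic⇒deg≡3 cv)))
      in cubic-path-absurd cv ca cb va vb vx (x∉ ∷ u)

  cubic⇒2≤h : ∀ {v} → cubic v ≡ true → 2 ≤ h v
  cubic⇒2≤h {v} cv = +-cancelˡ-≤ 1 2 _ (begin
    3          ≡⟨ cubic⇒deg≡3 cv ⟨
    deg v      ≡⟨ t+h≡deg v ⟨
    t v + h v  ≤⟨ +-monoˡ-≤ (h v) (cubic⇒t≤1 cv) ⟩
    1 + h v    ∎)
    where open ≤-Reasoning

  -- Since `h v ≥ 2`, some non-cubic neighbour of `v` differs from `w`; it lies in the same K4 as
  -- `w`.
  second-noncubic : ∀ {v w} → cubic v ≡ true → v ~ w →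
                    ∃ λ x → cubic x ≡ false × v ~ x × w ~ x
  second-noncubic {v} {w} cv vw with another false v (w ∷ []) (cubic⇒2≤h cv)
  ... | x , vx , cx , x≢w ∷ [] = x , cx , vx , cubic-clique cv vw vx (x≢w ∘ sym)

  count-nbr : ∀ {b v xs} → Unique xs → All (λ u → v ~ u × cubic u ≡ b) xs → length xs ≤ count (nbr b v)
  count-nbr {b} {v} ux p = count-distinct (nbr b v) ux (All.map (λ (e , q) → nbr⁺ e q) p)

  -- If the chosen neighbour of `v` is cubic, its K4 contains a non-cubic vertex other than `v`,
  -- which is adjacent to `v`.
  1≤h : ∀ v → 1 ≤ h v
  1≤h v with fresh (adj G v) [] (≤-trans (s≤s z≤n) (3≤deg v))
  ... | z , vz , [] with cubic z in eq
  ... | false = count-nbr ([] ∷ []) ((vz , eq) ∷ [])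
  ... | true with second-noncubic eq (~-sym vz)
  ... | x , cx , _ , vx = count-nbr ([] ∷ []) ((vx , cx) ∷ [])

  t<deg : ∀ v → t v < deg v
  t<deg v = begin
    1 + t v    ≡⟨ +-comm 1 (t v) ⟩
    t v + 1    ≤⟨ +-monoʳ-≤ (t v) (1≤h v) ⟩
    t v + h v  ≡⟨ t+h≡deg v ⟩
    deg v      ∎
    where open ≤-Reasoning

  -- A cubic neighbour `u` of `v` differs from the non-cubic `w`, so both lie in the K4 of `v` and
  -- are adjacent.
  cubic-partner : ∀ {v w} → cubic v ≡ true → v ~ w → cubic w ≡ false → 1 ≤ t v →
                  ∃ λ u → cubic u ≡ true × v ~ u × w ~ u
  cubic-partner {v} {w} cv vw cw 1≤t with another true v [] 1≤t
  ... | u , vu , cu , [] = u , cu , vu , cubic-clique cv vw vu (λ w≡u → cubic≢ cu cw (sym w≡u))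

  -- With a single non-cubic neighbour x, every cubic neighbour of w has exactly one cubic
  -- neighbour, again in N(w): the three cubic neighbours would be perfectly matched.
  deg4⇒2≤h : ∀ {w} → cubic w ≡ false → deg w ≡ 4 → 2 ≤ h w
  deg4⇒2≤h {w} cw d≡4 = ≮⇒≥ absurd
    where
    absurd : ¬ h w < 2
    absurd h<2 = matched (choose (nbr true w) 3 3≤t)
      where
      h≡1 : h w ≡ 1
      h≡1 = ≤-antisym (s≤s⁻¹ h<2) (1≤h w)
      t≡3 : t w ≡ 3
      t≡3 = +-cancelʳ-≡ 1 (t w) 3 (trans (cong (t w +_) (sym h≡1)) (trans (t+h≡deg w) d≡4))
      3≤t : 3 ≤ t w
      3≤t = ≤-reflexive (sym t≡3)
      partner : ∀ {v} → w ~ v → cubic v ≡ true → ∃ λ u → cubic u ≡ true × v ~ u × w ~ u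
      partner {v} wv cv with 1 ≤? t v
      ... | yes 1≤tv = cubic-partner cv (~-sym wv) cw 1≤tv
      -- With `t v = 0` all three neighbours of `v` are non-cubic; one that is neither `w` nor `x`
      -- would be a second non-cubic neighbour of `w`.
      ... | no  1≰tv with another false w [] (1≤h w)
      ... | x , wx , cx , [] with another false v (w ∷ x ∷ [])
                                   (≤-reflexive (sym (trans (cong (_+ h v) (sym (n<1⇒n≡0 (≰⇒> 1≰tv))))
                                                       (trans (t+h≡deg v) (cubic⇒deg≡3 cv)))))
      ... | y , vy , cy , y≢w ∷ y≢x ∷ [] = contradiction
              (count-nbr {false} {w} ((y≢x ∷ []) ∷ [] ∷ [])
                ((cubic-clique cv (~-sym wv) vy (y≢w ∘ sym) , cy) ∷ (wx , cx) ∷ []))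
              (<⇒≱ h<2)
      matched : ¬ (∃ λ xs → length xs ≡ 3 × Unique xs × All (λ x → nbr true w x ≡ true) xs)
      matched (a ∷ b ∷ c ∷ [] , refl , uxs@((a≢b ∷ a≢c ∷ []) ∷ (b≢c ∷ []) ∷ [] ∷ []) , pxs@(pa ∷ pb ∷ pc ∷ [])) =
        let wa , ca = nbr⁻ pa
            wb , cb = nbr⁻ pb
            wc , cc = nbr⁻ pc
        in cases ca cb cc (partner wa ca) (partner wb cb) (partner wc cc)
        where
        only : ∀ {u} → cubic u ≡ true → w ~ u → u ∈ a ∷ b ∷ c ∷ []
        only cu wu = exhausted (nbr true w) uxs pxs (≤-reflexive t≡3) (nbr⁺ wu cu)
        two : ∀ {u y z} → cubic u ≡ true → y ≢ z → u ~ y → cubic y ≡ true → u ~ z → cubic z ≡ true → ⊥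
        two cu y≢z uy cy uz cz =
          <⇒≱ (count-nbr ((y≢z ∷ []) ∷ [] ∷ []) ((uy , cy) ∷ (uz , cz) ∷ [])) (cubic⇒t≤1 cu)
        cases : cubic a ≡ true → cubic b ≡ true → cubic c ≡ true →
                (∃ λ u → cubic u ≡ true × a ~ u × w ~ u) → (∃ λ u → cubic u ≡ true × b ~ u × w ~ u) →
                (∃ λ u → cubic u ≡ true × c ~ u × w ~ u) → ⊥
        cases ca cb cc (u , cu , au , wu) (v , cv , bv , wv) (z , cz , c~z , wz)
          -- Three vertices cannot be paired off: every choice of partners gives one of `a`, `b`,
          -- `c` two cubic neighbours, against `cubic⇒t≤1`.
          with only cu wu | only cv wv | only cz wz
        ... | here refl | _ | _ = ~⇒≢ au refl
        ... | _ | there (here refl) | _ = ~⇒≢ bv refl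
        ... | _ | _ | there (there (here refl)) = ~⇒≢ c~z refl
        ... | there (here refl) | _ | here refl = two ca b≢c au cb (~-sym c~z) cc
        ... | there (here refl) | _ | there (here refl) = two cb a≢c (~-sym au) ca (~-sym c~z) cc
        ... | there (there (here refl)) | here refl | _ = two ca (b≢c ∘ sym) au cc (~-sym bv) cb
        ... | there (there (here refl)) | there (there (here refl)) | _ = two cc a≢b (~-sym au) ca (~-sym bv) cb

  deg4⇒t≤2 : ∀ {w} → cubic w ≡ false → deg w ≡ 4 → t w ≤ 2
  deg4⇒t≤2 {w} cw d≡4 = +-cancelʳ-≤ 2 (t w) 2 (begin
    t w + 2    ≤⟨ +-monoʳ-≤ (t w) (deg4⇒2≤h cw d≡4) ⟩
    t w + h w  ≡⟨ trans (t+h≡deg w) d≡4 ⟩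
    4          ∎)
    where open ≤-Reasoning

  -- Four times the charge deg v − 7/2 left at v after every non-cubic vertex has given 1/4 to
  -- each of its cubic neighbours; for cubic v it is h v − 2 = 1 − t v.
  slack : Fin n → ℕ
  slack v = if cubic v then 1 ∸ t v else 4 * deg v ∸ (14 + t v)

  -- Both are measured in units of 1/4, so that each gift counts 1.
  given received : Fin n → ℕ
  given    v = if cubic v then 0 else t v
  received v = if cubic v then h v else 0

  slack-cubic : ∀ {v} → cubic v ≡ true → slack v ≡ 1 ∸ t v
  slack-cubic cv rewrite cv = refl

  slack-noncubic : ∀ {v} → cubic v ≡ false → slack v ≡ 4 * deg v ∸ (14 + t v)
  slack-noncubic cv rewrite cv = refl

  -- Makes the truncated subtraction in `slack` exact. In degree 4 it amounts to `t v ≤ 2`; from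
  -- degree 5 on, `t v < deg v` suffices.
  solvent : ∀ {v} → cubic v ≡ false → 14 + t v ≤ 4 * deg v
  solvent {v} cv with m≤n⇒m<n∨m≡n (4≤deg cv)
  ... | inj₂ 4≡d = subst (λ d → 14 + t v ≤ 4 * d) 4≡d (+-monoʳ-≤ 14 (deg4⇒t≤2 cv (sym 4≡d)))
  ... | inj₁ 5≤d = begin
    14 + t v             ≡⟨ +-comm 13 (1 + t v) ⟩
    1 + t v + 13         ≤⟨ +-mono-≤ (t<deg v) (≤-trans (m≤m+n 13 2) (*-monoʳ-≤ 3 5≤d)) ⟩
    deg v + 3 * deg v    ∎
    where open ≤-Reasoning

  -- The account of a single vertex in quarter units: initial charge `4 * deg v - 14`, plus gifts
  -- received, minus gifts made, is the slack. Terms are moved across so that everything is a sum.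
  balance : ∀ v → 4 * deg v + received v ≡ (14 + given v) + slack v
  balance v with cubic v in cv
  ... | false = trans (+-identityʳ _) (sym (m+[n∸m]≡n (solvent cv)))
  ... | true rewrite cubic⇒deg≡3 cv = cong (12 +_) (arith (t v) (h v) (trans (t+h≡deg v) (cubic⇒deg≡3 cv)) (cubic⇒t≤1 cv))
    where
    arith : ∀ a b → a + b ≡ 3 → a ≤ 1 → b ≡ 2 + (1 ∸ a)
    arith zero       b p _ = p
    arith (suc zero) b p _ = suc-injective p
    arith (suc (suc a)) b p (s≤s ())

  -- Double counting of the matrix `gift`: its row sums are what is given, its column sums what is
  -- received.
  ∑given≡∑received : sum given ≡ sum received
  ∑given≡∑received = begin
    sum given                        ≡⟨ sum-cong-≗ given-row ⟩
    ∑[ v < n ] ∑[ u < n ] gift v u   ≡⟨ ∑-comm gift ⟩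
    ∑[ u < n ] ∑[ v < n ] gift v u   ≡⟨ sum-cong-≗ received-column ⟨
    sum received                     ∎
    where
    open ≡-Reasoning
    gift : Fin n → Fin n → ℕ
    gift v u = if cubic v then 0 else 𝟙 (nbr true v u)
    given-row : ∀ v → given v ≡ ∑[ u < n ] gift v u
    given-row v with cubic v
    ... | true  = sym (∑-zero {n} (λ _ → refl))
    ... | false = count-∑ (nbr true v)
    same : ∀ {u} → cubic u ≡ true → ∀ v → 𝟙 (nbr false u v) ≡ gift v u
    same {u} cu v rewrite adj-sym G u v | cu with adj G v u | cubic v
    ... | true  | true  = refl
    ... | true  | false = refl
    ... | false | true  = refl
    ... | false | false = refl
    none : ∀ {u} → cubic u ≡ false → ∀ v → gift v u ≡ 0
    none {u} cu v rewrite cu with adj G v u | cubic v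
    ... | true  | true  = refl
    ... | true  | false = refl
    ... | false | true  = refl
    ... | false | false = refl
    received-column : ∀ u → received u ≡ ∑[ v < n ] gift v u
    received-column u = by-cases (cubic u) refl
      where
      by-cases : ∀ b → cubic u ≡ b → received u ≡ ∑[ v < n ] gift v u
      by-cases true  cu = trans (cong (if_then h u else 0) cu) (trans (count-∑ (nbr false u)) (sum-cong-≗ (same cu)))
      by-cases false cu = trans (cong (if_then h u else 0) cu) (sym (∑-zero (none cu)))

  -- Summed over all vertices, `balance` loses the gifts, and `8 * size G` is four times the degree
  -- sum.
  8*size : 8 * size G ≡ 14 * n + sum slack
  8*size = +-cancelʳ-≡ (sum received) _ _ (begin
    8 * size G + sum received                         ≡⟨ cong (_+ sum received) eight ⟩
    ∑[ v < n ] (4 * deg v) + sum received             ≡⟨ ∑-distrib-+ (λ v → 4 * deg v) received ⟨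
    ∑[ v < n ] (4 * deg v + received v)               ≡⟨ sum-cong-≗ balance ⟩
    ∑[ v < n ] ((14 + given v) + slack v)             ≡⟨ ∑-distrib-+ (λ v → 14 + given v) slack ⟩
    ∑[ v < n ] (14 + given v) + sum slack             ≡⟨ cong (_+ sum slack) (∑-distrib-+ (λ _ → 14) given) ⟩
    ∑[ v < n ] 14 + sum given + sum slack             ≡⟨ cong₂ (λ a b → a + b + sum slack)
                                                           (trans (∑-const n 14) (*-comm n 14)) ∑given≡∑received ⟩
    14 * n + sum received + sum slack                 ≡⟨ swap (14 * n) (sum received) (sum slack) ⟩
    14 * n + sum slack + sum received                 ∎)
    where
    open ≡-Reasoning
    swap : ∀ a b c → a + b + c ≡ a + c + b
    swap = solve-∀
    eight : 8 * size G ≡ ∑[ v < n ] (4 * deg v)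
    eight = begin
      8 * size G                 ≡⟨ *-assoc 4 2 (size G) ⟩
      4 * (2 * size G)           ≡⟨ cong (4 *_) (handshake G) ⟨
      4 * (∑[ v < n ] deg v)     ≡⟨ *-distribˡ-sum 4 deg ⟩
      ∑[ v < n ] (4 * deg v)     ∎

  -- Parity of degrees.

  cubicPart : Graph n
  cubicPart .adj i j        = adj G i j ∧ (cubic i ∧ cubic j)
  cubicPart .adj-sym i j    = cong₂ _∧_ (adj-sym G i j) (∧-comm (cubic i) (cubic j))
  cubicPart .adj-irrefl i   = cong (_∧ (cubic i ∧ cubic i)) (adj-irrefl G i)

  -- The total is even by two handshakes, while the value is `3 + t v` at a cubic vertex and `deg v`
  -- elsewhere. As `t v ≤ 1` for cubic `v`, odd values mark the cubic vertices without cubic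
  -- neighbour and the non-cubic vertices of odd degree.
  oddity : Fin n → ℕ
  oddity v = deg v + degree cubicPart v

  2∣∑oddity : 2 ∣ sum oddity
  2∣∑oddity = subst (2 ∣_)
    (sym (trans (∑-distrib-+ deg (degree cubicPart)) (cong₂ _+_ (handshake G) (handshake cubicPart))))
    (∣m∣n⇒∣m+n (m∣m*n (size G)) (m∣m*n (size cubicPart)))

  oddity-cubic : ∀ {v} → cubic v ≡ true → oddity v ≡ 3 + t v
  oddity-cubic {v} cv = cong₂ _+_ (cubic⇒deg≡3 cv)
    (trans (count-∑ (adj cubicPart v)) (trans (sum-cong-≗ same) (sym (count-∑ (nbr true v)))))
    where
    same : ∀ u → 𝟙 (adj cubicPart v u) ≡ 𝟙 (nbr true v u)
    same u rewrite cv with adj G v u | cubic u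
    ... | true  | true  = refl
    ... | true  | false = refl
    ... | false | _     = refl

  oddity-noncubic : ∀ {v} → cubic v ≡ false → oddity v ≡ deg v
  oddity-noncubic {v} cv = trans (cong (deg v +_) (trans (count-∑ (adj cubicPart v)) (∑-zero none)))
                                 (+-identityʳ (deg v))
    where
    none : ∀ u → 𝟙 (adj cubicPart v u) ≡ 0
    none u rewrite cv with adj G v u
    ... | true  = refl
    ... | false = refl

  -- The total of `oddity` is even, so a single odd value is impossible.
  another-odd : ∀ {w} → ¬ 2 ∣ oddity w → ∃ λ v → v ≢ w × ¬ 2 ∣ oddity v
  another-odd {w} odd with any? (λ v → ¬? (v ≟ w) ×-dec ¬? (2 ∣? oddity v))
  ... | yes found = found
  ... | no  none  = contradiction (∣m+n∣m⇒∣n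
      (subst (2 ∣_) (trans (∑-split oddity w) (+-comm (oddity w) _)) 2∣∑oddity)
      (∑-∣ (∖-∣ oddity w rest))) odd
    where
    rest : ∀ y → w ≢ y → 2 ∣ oddity y
    rest y w≢y = decidable-stable (2 ∣? oddity y) (λ ¬even → none (y , w≢y ∘ sym , ¬even))

  neighbours : ∀ w → ∃ λ xs → length xs ≡ deg w × (∀ {z} → w ~ z → z ∈ xs)
  neighbours w = let xs , len , uxs , pxs = choose (adj G w) (deg w) ≤-refl
                 in xs , len , exhausted (adj G w) uxs pxs (≤-reflexive (sym len))

  -- Such an `N[w]` would be a component with at most 7 vertices, but `G` is connected of order at
  -- least 8.
  no-closed-neighbourhood : ∀ {w} → deg w ≤ 6 → ¬ (∀ {u z} → w ~ u → u ~ z → z ≡ w ⊎ w ~ z)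
  no-closed-neighbourhood {w} d≤6 closed = outside (neighbours w)
    where
    Q : Fin n → Set
    Q u = u ≡ w ⊎ w ~ u
    Q-closed : ∀ {u z} → Q u → ⊤ → u ~ z → Q z
    Q-closed (inj₁ refl) _ uz = inj₂ uz
    Q-closed (inj₂ wu)   _ uz = closed wu uz
    outside : ¬ (∃ λ xs → length xs ≡ deg w × (∀ {z} → w ~ z → z ∈ xs))
    outside (xs , len , inside) = missed (fresh (λ _ → true) (w ∷ xs)
        (subst₂ _≤_ (cong (2 +_) (sym len)) (sym count-all) (≤-trans (+-monoʳ-≤ 2 d≤6) 8≤n)))
      where
      missed : ¬ (∃ λ y → true ≡ true × All (y ≢_) (w ∷ xs))
      missed (y , _ , y≢w ∷ y∉) with walk-invariant Q-closed (connected w y) (inj₁ refl)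
      ... | inj₁ y≡w = y≢w y≡w
      ... | inj₂ wy  = All.lookup y∉ (inside wy) refl

  -- These are the cubic vertices with positive slack: two gifts are needed, and three arrive.
  Lone : Fin n → Set
  Lone v = cubic v ≡ true × t v ≡ 0

  lone-slack : ∀ {v} → Lone v → slack v ≡ 1
  lone-slack (cv , t≡0) = trans (slack-cubic cv) (cong (1 ∸_) t≡0)

  lone-h : ∀ {v} → Lone v → h v ≡ 3
  lone-h {v} (cv , t≡0) = trans (cong (_+ h v) (sym t≡0)) (trans (t+h≡deg v) (cubic⇒deg≡3 cv))

  lone-nbr : ∀ {v u} → Lone v → v ~ u → cubic u ≡ false
  lone-nbr {v} {u} (cv , t≡0) vu with cubic u in cu
  ... | false = refl
  ... | true  = contradiction (subst (1 ≤_) t≡0 (count-nbr ([] ∷ []) ((vu , cu) ∷ []))) (λ ())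

  slack-deg4 : ∀ {w} → deg w ≡ 4 → slack w ≡ 2 ∸ t w
  slack-deg4 {w} d≡4 = trans (slack-noncubic (cong (_≡ᵇ 3) d≡4)) (cong (λ d → 4 * d ∸ (14 + t w)) d≡4)

  slack-deg5 : ∀ {w} → deg w ≡ 5 → slack w ≡ 6 ∸ t w
  slack-deg5 {w} d≡5 = trans (slack-noncubic (cong (_≡ᵇ 3) d≡5)) (cong (λ d → 4 * d ∸ (14 + t w)) d≡5)

  -- A cubic neighbour v′ ≠ v of z is not adjacent to v, and if it had a cubic neighbour u then
  -- v, v′ and u would be three cubic neighbours of z.
  second-lone : ∀ {v z} → Lone v → v ~ z → deg z ≡ 4 → 2 ≤ t z →
                ∃ λ v′ → Lone v′ × v′ ≢ v × z ~ v′
  second-lone {v} {z} lv@(cv , _) vz d≡4 2≤t with another true z (v ∷ []) 2≤t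
  ... | v′ , zv′ , cv′ , v′≢v ∷ [] = v′ , (cv′ , n<1⇒n≡0 (≰⇒> alone)) , v′≢v , zv′
    where
    cz : cubic z ≡ false
    cz = lone-nbr lv vz
    alone : ¬ 1 ≤ t v′
    alone 1≤t with cubic-partner cv′ (~-sym zv′) cz 1≤t
    ... | u , cu , v′u , zu = <⇒≱
      (count-nbr {true} {z} ((v′≢v ∷ ~⇒≢ v′u ∷ []) ∷ (v≢u ∷ []) ∷ [] ∷ [])
        ((zv′ , cv′) ∷ (~-sym vz , cv) ∷ (zu , cu) ∷ []))
      (deg4⇒t≤2 cz d≡4)
      where
      v≢u : v ≢ u
      v≢u refl = cubic≢ cv′ (lone-nbr lv (~-sym v′u)) refl

  -- Total slack at most 4 forces total slack 0.

  module Tight (∑slack≤4 : sum slack ≤ 4) where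

    overspent : ∀ {xs} → Unique xs → ¬ 5 ≤ ListAction.sum (map slack xs)
    overspent uxs 5≤ = <⇒≱ 5≤ (≤-trans (∑-distinct slack uxs) ∑slack≤4)

    -- A vertex of degree `d ≥ 6` makes at most `d - 1` gifts and keeps slack at least
    -- `3d - 13 ≥ 5`.
    deg≤5 : ∀ v → deg v ≤ 5
    deg≤5 v with cubic v in cv
    ... | true  = ≤-trans (≤-reflexive (cubic⇒deg≡3 cv)) (m≤m+n 3 2)
    ... | false = ≮⇒≥ λ 6≤d → overspent {v ∷ []} ([] ∷ [])
      (subst (5 ≤_) (sym (trans (+-identityʳ _) (slack-noncubic cv))) (m+n≤o⇒m≤o∸n 5 (rich 6≤d)))
      where
      rich : 6 ≤ deg v → 5 + (14 + t v) ≤ 4 * deg v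
      rich 6≤d = begin
        19 + t v             ≡⟨ +-comm 18 (1 + t v) ⟩
        1 + t v + 18         ≤⟨ +-mono-≤ (t<deg v) (*-monoʳ-≤ 3 6≤d) ⟩
        deg v + 3 * deg v    ∎
        where open ≤-Reasoning

    deg-4-or-5 : ∀ {v} → cubic v ≡ false → deg v ≡ 4 ⊎ deg v ≡ 5
    deg-4-or-5 {v} cv with m≤n⇒m<n∨m≡n (4≤deg cv)
    ... | inj₁ 5≤d = inj₂ (≤-antisym (deg≤5 v) 5≤d)
    ... | inj₂ 4≡d = inj₁ (sym 4≡d)

    -- In the remaining cases `oddity v` is 4: a cubic vertex with one cubic neighbour, or a vertex
    -- of degree 4.
    odd⇒lone-or-deg5 : ∀ {v} → ¬ 2 ∣ oddity v → Lone v ⊎ deg v ≡ 5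
    odd⇒lone-or-deg5 {v} odd = by-cases (cubic v) refl
      where
      by-cases : ∀ b → cubic v ≡ b → Lone v ⊎ deg v ≡ 5
      by-cases true cv with m≤n⇒m<n∨m≡n (cubic⇒t≤1 cv)
      ... | inj₁ t<1 = inj₁ (cv , n<1⇒n≡0 t<1)
      ... | inj₂ t≡1 = contradiction
              (subst (2 ∣_) (sym (trans (oddity-cubic cv) (cong (3 +_) t≡1))) (divides 2 refl)) odd
      by-cases false cv with deg-4-or-5 cv
      ... | inj₂ d≡5 = inj₂ d≡5
      ... | inj₁ d≡4 = contradiction
              (subst (2 ∣_) (sym (trans (oddity-noncubic cv) d≡4)) (divides 2 refl)) odd

    -- If w has a unique non-cubic neighbour x, then x is adjacent to all cubic neighbours of w,
    -- so N[w] = N[x] would be a component of order 6.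
    deg5⇒t≤3 : ∀ {w} → deg w ≡ 5 → t w ≤ 3
    deg5⇒t≤3 {w} d≡5 = ≮⇒≥ (λ 4≤t → component 4≤t (choose (nbr true w) 4 4≤t) (another false w [] (1≤h w)))
      where
      cw : cubic w ≡ false
      cw = cong (_≡ᵇ 3) d≡5
      component : 4 ≤ t w → (∃ λ xs → length xs ≡ 4 × Unique xs × All (λ x → nbr true w x ≡ true) xs) →
                  ¬ (∃ λ x → w ~ x × cubic x ≡ false × All (x ≢_) [])
      component 4≤t (xs , len , uxs , pxs) (x , wx , cx , _) =
        no-closed-neighbourhood {w} (≤-trans (≤-reflexive d≡5) (m≤m+n 5 1)) closed
        where
        h≤1 : h w ≤ 1
        h≤1 = +-cancelˡ-≤ 4 _ _ (begin
          4 + h w     ≤⟨ +-monoˡ-≤ (h w) 4≤t ⟩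
          t w + h w   ≡⟨ trans (t+h≡deg w) d≡5 ⟩
          5           ∎)
          where open ≤-Reasoning
        unique : ∀ {y} → cubic y ≡ false → w ~ y → y ≡ x
        unique {y} cy wy with y ≟ x
        ... | yes y≡x = y≡x
        ... | no  y≢x = contradiction
                (count-nbr {false} {w} ((y≢x ∷ []) ∷ [] ∷ []) ((wy , cy) ∷ (wx , cx) ∷ [])) (≤⇒≯ h≤1)
        joined : ∀ {v} → nbr true w v ≡ true → x ~ v
        joined p = let wv , cv = nbr⁻ p
                       x′ , cx′ , vx′ , wx′ = second-noncubic cv (~-sym wv)
                   in ~-sym (subst (_ ~_) (unique cx′ wx′) vx′)
        x-nbr : ∀ {z} → x ~ z → z ∈ w ∷ xs
        -- The vertex `w` and its four cubic neighbours are already five neighbours of `x`, the most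
        -- that `deg≤5` allows.
        x-nbr = exhausted (adj G x)
          (All.map (λ p w≡v → cubic≢ (proj₂ (nbr⁻ p)) cw (sym w≡v)) pxs ∷ uxs)
          (~-sym wx ∷ All.map joined pxs)
          (≤-trans (deg≤5 x) (≤-reflexive (cong suc (sym len))))
        closed : ∀ {u z} → w ~ u → u ~ z → z ≡ w ⊎ w ~ z
        closed {u} wu uz with cubic u in cu
        ... | true  = cubic-neighbourhood cu (~-sym wu) uz
        ... | false with x-nbr (subst (_~ _) (unique cu wu) uz)
        ...   | here z≡w   = inj₁ z≡w
        ...   | there z∈xs = inj₂ (proj₁ (nbr⁻ (All.lookup pxs z∈xs)))

    deg5⇒3≤slack : ∀ {w} → deg w ≡ 5 → 3 ≤ slack w
    deg5⇒3≤slack d≡5 = subst (3 ≤_) (sym (slack-deg5 d≡5)) (∸-monoʳ-≤ 6 (deg5⇒t≤3 d≡5))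

    few-cubic⇒1≤slack : ∀ {z} → deg z ≡ 4 → ¬ 2 ≤ t z → 1 ≤ slack z
    few-cubic⇒1≤slack d≡4 t<2 = subst (1 ≤_) (sym (slack-deg4 d≡4)) (m<n⇒0<n∸m (≰⇒> t<2))

    -- By parity `w`, of slack at least 3, is accompanied by another odd vertex `o`. If `o` has
    -- degree 5, the total is at least 6. If `o` is lone, it adds 1, and a non-cubic neighbour `z`
    -- of `o` other than `w` supplies one more: from its own slack or from a second lone vertex next
    -- to it.
    deg≢5 : ∀ {w} → deg w ≢ 5
    deg≢5 {w} d≡5 = paired (another-odd λ even →
        from-no (2 ∣? 5) (subst (2 ∣_) (trans (oddity-noncubic cw) d≡5) even))
      where
      cw : cubic w ≡ false
      cw = cong (_≡ᵇ 3) d≡5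
      paired : ¬ (∃ λ o → o ≢ w × ¬ 2 ∣ oddity o)
      paired (o , o≢w , odd) with odd⇒lone-or-deg5 odd
      ... | inj₂ do≡5 = overspent {w ∷ o ∷ []} ((o≢w ∘ sym ∷ []) ∷ [] ∷ [])
              (≤-trans (m≤m+n 5 1) (+-mono-≤ (deg5⇒3≤slack d≡5) (+-mono-≤ (deg5⇒3≤slack do≡5) z≤n)))
      ... | inj₁ lo@(co , _) with another false o (w ∷ []) (cubic⇒2≤h co)
      ...   | z , oz , cz , z≢w ∷ [] = third
        where
        spend : ∀ {y} → w ≢ y → o ≢ y → ¬ 1 ≤ slack y
        spend w≢y o≢y 1≤y = overspent ((o≢w ∘ sym ∷ w≢y ∷ []) ∷ (o≢y ∷ []) ∷ [] ∷ [])
          (+-mono-≤ (deg5⇒3≤slack d≡5) (+-mono-≤ (≤-reflexive (sym (lone-slack lo))) (+-mono-≤ 1≤y z≤n)))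
        third : ⊥
        third with deg-4-or-5 cz
        ... | inj₂ dz≡5 = spend (z≢w ∘ sym) (~⇒≢ oz) (≤-trans (m≤m+n 1 2) (deg5⇒3≤slack dz≡5))
        ... | inj₁ dz≡4 with 2 ≤? t z
        ...   | no  t<2 = spend (z≢w ∘ sym) (~⇒≢ oz) (few-cubic⇒1≤slack dz≡4 t<2)
        ...   | yes 2≤t with second-lone lo oz dz≡4 2≤t
        ...     | v , lv , v≢o , _ = spend (λ w≡v → cubic≢ (proj₁ lv) cw (sym w≡v)) (v≢o ∘ sym)
                                           (≤-reflexive (sym (lone-slack lv)))

    deg≡4 : ∀ {v} → cubic v ≡ false → deg v ≡ 4
    deg≡4 cv with deg-4-or-5 cv
    ... | inj₁ d≡4 = d≡4
    ... | inj₂ d≡5 = contradiction d≡5 deg≢5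

    -- Otherwise N[w] is K5 minus an edge, a component of order 5.
    lone⇒t<2 : ∀ {v w} → Lone v → v ~ w → ¬ 2 ≤ t w
    lone⇒t<2 {v} {w} lv@(cv , _) vw 2≤t with second-lone lv vw (deg≡4 (lone-nbr lv vw)) 2≤t
    ... | v′ , lv′@(cv′ , _) , v′≢v , wv′ with fresh (adj G v) (w ∷ []) (≤-trans (m≤m+n 2 1) (3≤deg v))
    ... | x , vx , x≢w ∷ [] with fresh (adj G v) (x ∷ w ∷ []) (3≤deg v)
    ... | y , vy , y≢x ∷ y≢w ∷ [] = no-closed-neighbourhood {w} (≤-trans (≤-reflexive dw≡4) (m≤m+n 4 2)) closed
      where
      cx : cubic x ≡ false
      cx = lone-nbr lv vx
      cy : cubic y ≡ false
      cy = lone-nbr lv vy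
      wx : w ~ x
      wx = cubic-clique cv vw vx (x≢w ∘ sym)
      wy : w ~ y
      wy = cubic-clique cv vw vy (y≢w ∘ sym)
      xy : x ~ y
      xy = cubic-clique cv vx vy (y≢x ∘ sym)
      dw≡4 : deg w ≡ 4
      dw≡4 = deg≡4 (lone-nbr lv vw)
      w-nbr : ∀ {z} → w ~ z → z ∈ v ∷ v′ ∷ x ∷ y ∷ []
      w-nbr = exhausted (adj G w)
        ((v′≢v ∘ sym ∷ ~⇒≢ vx ∷ ~⇒≢ vy ∷ []) ∷ (cubic≢ cv′ cx ∷ cubic≢ cv′ cy ∷ []) ∷ (y≢x ∘ sym ∷ []) ∷ [] ∷ [])
        (~-sym vw ∷ wv′ ∷ wx ∷ wy ∷ []) (≤-reflexive dw≡4)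
      v′-other : ∀ {z} → v′ ~ z → z ≢ w → z ≡ x ⊎ z ≡ y
      v′-other v′z z≢w with w-nbr (cubic-clique cv′ (~-sym wv′) v′z (z≢w ∘ sym))
      ... | here refl                         = ⊥-elim (cubic≢ cv (lone-nbr lv′ v′z) refl)
      ... | there (here refl)                 = ⊥-elim (~⇒≢ v′z refl)
      ... | there (there (here z≡x))          = inj₁ z≡x
      ... | there (there (there (here z≡y)))  = inj₂ z≡y
      -- Apart from `w`, only `x` and `y` can be neighbours of `v′`, so its degree of at least 3
      -- forces both.
      v′x : v′ ~ x
      v′x with fresh (adj G v′) (w ∷ y ∷ []) (3≤deg v′)
      ... | z , v′z , z≢w ∷ z≢y ∷ [] with v′-other v′z z≢w
      ...   | inj₁ refl = v′z
      ...   | inj₂ z≡y  = contradiction z≡y z≢y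
      v′y : v′ ~ y
      v′y with fresh (adj G v′) (w ∷ x ∷ []) (3≤deg v′)
      ... | z , v′z , z≢w ∷ z≢x ∷ [] with v′-other v′z z≢w
      ...   | inj₁ z≡x  = contradiction z≡x z≢x
      ...   | inj₂ refl = v′z
      -- Serves `x` and `y` alike: `v`, `v′`, `w` and the other one, `b`, exhaust the four
      -- neighbours of `a`.
      inner : ∀ {a b} → cubic a ≡ false → v ~ a → v′ ~ a → a ~ b → w ~ a → w ~ b → v ~ b → v′ ≢ b →
              ∀ {z} → a ~ z → z ≡ w ⊎ w ~ z
      inner {a} {b} ca va v′a ab wa wb vb v′≢b az
        with exhausted (adj G a) {v ∷ v′ ∷ w ∷ b ∷ []}
               ((v′≢v ∘ sym ∷ ~⇒≢ vw ∷ ~⇒≢ vb ∷ []) ∷ (~⇒≢ wv′ ∘ sym ∷ v′≢b ∷ []) ∷ (~⇒≢ wb ∷ []) ∷ [] ∷ [])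
               (~-sym va ∷ ~-sym v′a ∷ ~-sym wa ∷ ab ∷ []) (≤-reflexive (deg≡4 ca)) az
      ... | here refl                         = inj₂ (~-sym vw)
      ... | there (here refl)                 = inj₂ wv′
      ... | there (there (here z≡w))          = inj₁ z≡w
      ... | there (there (there (here refl))) = inj₂ wb
      closed : ∀ {u z} → w ~ u → u ~ z → z ≡ w ⊎ w ~ z
      closed wu uz with w-nbr wu
      ... | here refl                         = cubic-neighbourhood cv vw uz
      ... | there (here refl)                 = cubic-neighbourhood cv′ (~-sym wv′) uz
      ... | there (there (here refl))         = inner cx vx v′x xy wx wy vy (cubic≢ cv′ cy) uz
      ... | there (there (there (here refl))) = inner cy vy v′y (~-sym xy) wy wx vx (cubic≢ cv′ cx) uz

    -- By parity there is a second lone vertex. Both have slack 1, and so has, at least, each of the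
    -- three non-cubic neighbours of `v`, by `lone⇒t<2`; that makes 5.
    no-lone : ∀ {v} → ¬ Lone v
    no-lone {v} lv@(cv , t≡0) = paired (another-odd λ even → from-no (2 ∣? 3)
        (subst (2 ∣_) (trans (oddity-cubic cv) (cong (3 +_) t≡0)) even))
      where
      paired : ¬ (∃ λ o → o ≢ v × ¬ 2 ∣ oddity o)
      paired (o , o≢v , odd) with odd⇒lone-or-deg5 odd
      ... | inj₂ do≡5 = deg≢5 do≡5
      ... | inj₁ lo = five (choose (nbr false v) 3 (≤-reflexive (sym (lone-h lv))))
        where
        1≤slack : ∀ {z} → nbr false v z ≡ true → 1 ≤ slack z
        1≤slack p = few-cubic⇒1≤slack (deg≡4 (proj₂ (nbr⁻ p))) (lone⇒t<2 lv (proj₁ (nbr⁻ p)))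
        five : ¬ (∃ λ xs → length xs ≡ 3 × Unique xs × All (λ x → nbr false v x ≡ true) xs)
        five (xs@(a ∷ b ∷ c ∷ []) , _ , uxs , pxs@(pa ∷ pb ∷ pc ∷ [])) = overspent
          ((o≢v ∘ sym ∷ All.map (cubic≢ cv ∘ proj₂ ∘ nbr⁻) pxs) ∷ All.map (cubic≢ (proj₁ lo) ∘ proj₂ ∘ nbr⁻) pxs ∷ uxs)
          (+-mono-≤ (≤-reflexive (sym (lone-slack lv))) (+-mono-≤ (≤-reflexive (sym (lone-slack lo)))
            (+-mono-≤ (1≤slack pa) (+-mono-≤ (1≤slack pb) (+-mono-≤ (1≤slack pc) z≤n)))))

    1≤t : ∀ {v} → cubic v ≡ true → 1 ≤ t v
    1≤t cv = n≢0⇒n>0 (λ t≡0 → no-lone (cv , t≡0))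

    -- With lone vertices excluded, a cubic neighbour of `z` has a cubic neighbour itself, which is
    -- adjacent to `z` as well.
    1≤t⇒2≤t : ∀ {z} → cubic z ≡ false → 1 ≤ t z → 2 ≤ t z
    1≤t⇒2≤t {z} cz 1≤tz with another true z [] 1≤tz
    ... | v , zv , cv , [] with cubic-partner cv (~-sym zv) cz (1≤t cv)
    ... | u , cu , vu , zu = count-nbr {true} {z} ((~⇒≢ vu ∷ []) ∷ [] ∷ []) ((zv , cv) ∷ (zu , cu) ∷ [])

    t≡0⇒slack≡2 : ∀ {z} → cubic z ≡ false → t z ≡ 0 → slack z ≡ 2
    t≡0⇒slack≡2 cz t≡0 = trans (slack-deg4 (deg≡4 cz)) (cong (2 ∸_) t≡0)

    h<3 : ∀ {z xs} → cubic z ≡ false → t z ≢ 0 → Unique xs → All (λ u → z ~ u × cubic u ≡ false) xs →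
          length xs < 3
    h<3 {z} {xs} cz t≢ uxs pxs = s≤s (+-cancelˡ-≤ 2 _ _ (begin
      2 + length xs   ≤⟨ +-mono-≤ (1≤t⇒2≤t cz (n≢0⇒n>0 t≢)) (count-nbr uxs pxs) ⟩
      t z + h z       ≡⟨ trans (t+h≡deg z) (deg≡4 cz) ⟩
      4               ∎))
      where open ≤-Reasoning

    -- If t w = 0 then all neighbours of w are non-cubic. On a cycle in N(w), at least one of two
    -- consecutive vertices has slack 0; it has two cubic neighbours and, besides, w and its two
    -- neighbours on the cycle, although its degree is 4.
    t≢0 : ∀ {w} → cubic w ≡ false → t w ≢ 0
    t≢0 {w} cw t≡0 with nonforesty w
    ... | m , c , inj , hub , path , close = absurd
      where
      i₁ i₂ : Fin (3 + m)
      i₁ = fsuc fzero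
      i₂ = fsuc (fsuc fzero)
      noncubic : ∀ {u} → w ~ u → cubic u ≡ false
      noncubic {u} wu with cubic u in cu
      ... | false = refl
      ... | true  = contradiction (subst (1 ≤_) t≡0 (count-nbr ([] ∷ []) ((wu , cu) ∷ []))) (λ ())
      crowded : ∀ {z p q} → w ~ z → w ~ p → w ~ q → p ≢ q → z ~ p → z ~ q → t z ≢ 0 → ⊥
      crowded {z} {p} {q} wz wp wq p≢q zp zq t≢ = <⇒≱
        (h<3 (noncubic wz) t≢ ((~⇒≢ wp ∷ ~⇒≢ wq ∷ []) ∷ (p≢q ∷ []) ∷ [] ∷ [])
          ((~-sym wz , cw) ∷ (zp , noncubic wp) ∷ (zq , noncubic wq) ∷ [])) ≤-refl
      absurd : ⊥
      absurd with t (c fzero) ≟ⁿ 0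
      ... | no  t≢ = crowded (hub _) (hub i₁) (hub (fromℕ _)) ((λ ()) ∘ inj) (path fzero) (~-sym close) t≢
      ... | yes t₀≡0 with t (c i₁) ≟ⁿ 0
      ...   | no  t≢ = crowded (hub i₁) (hub fzero) (hub i₂) ((λ ()) ∘ inj) (~-sym (path fzero)) (path (fsuc fzero)) t≢
      -- Now `w` and the first two vertices of the cycle have slack 2 each, in total 6.
      ...   | yes t₁≡0 = overspent {w ∷ c fzero ∷ c i₁ ∷ []}
                ((~⇒≢ (hub _) ∷ ~⇒≢ (hub _) ∷ []) ∷ (~⇒≢ (path fzero) ∷ []) ∷ [] ∷ [])
                (≤-trans (m≤m+n 5 1) (≤-reflexive (sym (cong₂ _+_ (t≡0⇒slack≡2 cw t≡0)
                  (cong₂ _+_ (t≡0⇒slack≡2 (noncubic (hub _)) t₀≡0)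
                    (cong (_+ 0) (t≡0⇒slack≡2 (noncubic (hub _)) t₁≡0)))))))

    slack≡0 : ∀ w → slack w ≡ 0
    slack≡0 w = by-cases (cubic w) refl
      where
      by-cases : ∀ b → cubic w ≡ b → slack w ≡ 0
      by-cases true  cw = trans (slack-cubic cw) (m≤n⇒m∸n≡0 (1≤t cw))
      by-cases false cw = trans (slack-deg4 (deg≡4 cw)) (m≤n⇒m∸n≡0 (1≤t⇒2≤t cw (n≢0⇒n>0 (t≢0 cw))))

  slack-gap : sum slack ≤ 4 → sum slack ≡ 0
  slack-gap ≤4 = ∑-zero (Tight.slack≡0 ≤4)

-- Arithmetic of the bound.

surplus : ℕ → ℕ
surplus 0 = 0
surplus 1 = 3
surplus 2 = 5
-- Meant for 3, the only other residue modulo 4.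
surplus _ = 6

-- A form free of truncated subtraction: seven edges for every four vertices, plus a correction
-- depending on the residue.
g-value : ∀ n → g n ≡ surplus (n % 4) + 7 * (n / 4)
g-value n with n % 4 | m%n<n n 4 | m≡m%n+[m/n]*n n 4
... | 0 | _ | eq = trans (cong (λ m → 2 * m ∸ n / 4) eq) (trans (cong (_∸ n / 4) (e (n / 4))) (m+n∸n≡m _ (n / 4)))
  where
  e : ∀ q → 2 * (0 + q * 4) ≡ (0 + 7 * q) + q
  e = solve-∀
... | 1 | _ | eq = trans (cong (λ m → 2 * m + 1 ∸ n / 4) eq) (trans (cong (_∸ n / 4) (e (n / 4))) (m+n∸n≡m _ (n / 4)))
  where
  e : ∀ q → 2 * (1 + q * 4) + 1 ≡ (3 + 7 * q) + q
  e = solve-∀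
... | 2 | _ | eq = trans (cong (λ m → 2 * m + 1 ∸ n / 4) eq) (trans (cong (_∸ n / 4) (e (n / 4))) (m+n∸n≡m _ (n / 4)))
  where
  e : ∀ q → 2 * (2 + q * 4) + 1 ≡ (5 + 7 * q) + q
  e = solve-∀
... | 3 | _ | eq = trans (cong (λ m → 2 * m ∸ n / 4) eq) (trans (cong (_∸ n / 4) (e (n / 4))) (m+n∸n≡m _ (n / 4)))
  where
  e : ∀ q → 2 * (3 + q * 4) ≡ (6 + 7 * q) + q
  e = solve-∀
... | suc (suc (suc (suc _))) | s≤s (s≤s (s≤s (s≤s ()))) | _

-- Let `n = 4q + r`. If `s < g n`, multiplying by 8 and cancelling `56 * q` leaves
-- `14 * r + S + 8 ≤ 8 * surplus r`. This is impossible for `r = 0` and `r = 3`; for `r = 1` and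
-- `r = 2` it gives `S ≤ 2` and `S ≤ 4`, hence `S = 0`, and then 8 would divide 14 or 28.
gap⇒size-bound : ∀ n {s S} → 8 * s ≡ 14 * n + S → (S ≤ 4 → S ≡ 0) → g n ≤ s
gap⇒size-bound n {s} {S} eq gap = subst (_≤ s) (sym (g-value n))
    (≮⇒≥ (λ small → excluded (n % 4) (m%n<n n 4) (m≡m%n+[m/n]*n n 4) small))
  where
  q : ℕ
  q = n / 4
  excluded : ∀ r → r < 4 → n ≡ r + q * 4 → ¬ s < surplus r + 7 * q
  excluded r r<4 n≡ small = by-residue r r<4 deficit integral
    where
    eq′ : 8 * s ≡ 14 * r + S + 56 * q
    eq′ = trans eq (trans (cong (λ m → 14 * m + S) n≡) (expand r q S))
      where
      expand : ∀ r q S → 14 * (r + q * 4) + S ≡ 14 * r + S + 56 * q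
      expand = solve-∀
    deficit : 14 * r + S + 8 ≤ 8 * surplus r
    deficit = +-cancelʳ-≤ (56 * q) _ _ (begin
      14 * r + S + 8 + 56 * q      ≡⟨ shift (14 * r + S) (56 * q) ⟩
      8 + (14 * r + S + 56 * q)    ≡⟨ cong (8 +_) eq′ ⟨
      8 + 8 * s                    ≡⟨ *-suc 8 s ⟨
      8 * suc s                    ≤⟨ *-monoʳ-≤ 8 small ⟩
      8 * (surplus r + 7 * q)      ≡⟨ expand (surplus r) q ⟩
      8 * surplus r + 56 * q       ∎)
      where
      open ≤-Reasoning
      shift : ∀ a b → a + 8 + b ≡ 8 + (a + b)
      shift = solve-∀
      expand : ∀ a q → 8 * (a + 7 * q) ≡ 8 * a + 56 * q
      expand = solve-∀
    integral : S ≤ 4 → 8 ∣ 14 * r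
    integral S≤4 = ∣m+n∣m⇒∣n (subst (8 ∣_) eq″ (m∣m*n s)) (subst (8 ∣_) (sym (*-assoc 8 7 q)) (m∣m*n (7 * q)))
      where
      eq″ : 8 * s ≡ 56 * q + 14 * r
      eq″ = trans eq′ (trans (cong (λ S → 14 * r + S + 56 * q) (gap S≤4))
                        (trans (cong (_+ 56 * q) (+-identityʳ (14 * r))) (+-comm (14 * r) (56 * q))))
    by-residue : ∀ r → r < 4 → 14 * r + S + 8 ≤ 8 * surplus r → ¬ (S ≤ 4 → 8 ∣ 14 * r)
    by-residue 0 _ d _ = contradiction (m+n≤o⇒n≤o S d) (λ ())
    by-residue 1 _ d i = from-no (8 ∣? 14) (i (≤-trans (+-cancelʳ-≤ 8 S 2 (+-cancelˡ-≤ 14 _ _ d)) (m≤m+n 2 2)))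
    by-residue 2 _ d i = from-no (8 ∣? 28) (i (+-cancelʳ-≤ 8 S 4 (+-cancelˡ-≤ 28 _ _ d)))
    by-residue 3 _ d _ = contradiction (m+n≤o⇒n≤o S (+-cancelˡ-≤ 42 _ 6 d)) (from-no (8 ≤? 6))
    by-residue (suc (suc (suc (suc _)))) (s≤s (s≤s (s≤s (s≤s ())))) _ _

-- Chains of blocks

none : ∀ {n} → Fin n → Bool
none _ = false

only : ∀ {n} → Fin n → Fin n → Bool
only a v = does (a ≟ v)

first : ∀ {n} k → (Fin n → Bool) → Fin (k + n) → Bool
first zero    f v        = f v
first (suc k) f fzero    = true
first (suc k) f (fsuc v) = first k f v

count-none : ∀ {n} → count {n} none ≡ 0
count-none {n} = trans (count-∑ none) (∑-zero {n} (λ _ → refl))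

only-self : ∀ {n} (a : Fin n) → only a a ≡ true
only-self a = dec-true (a ≟ a) refl

count-only : ∀ {n} (a : Fin n) → count (only a) ≡ 1
count-only a = trans (count-∑ (only a)) (trans (∑-split (𝟙 ∘ only a) a)
                 (cong₂ _+_ (cong 𝟙 (only-self a)) (∑-zero rest)))
  where
  rest : ∀ v → (𝟙 ∘ only a ∖ a) v ≡ 0
  rest v with does (a ≟ v)
  ... | true  = refl
  ... | false = refl

count-first : ∀ {n} k (f : Fin n → Bool) → count (first k f) ≡ k + count f
count-first zero    f = refl
count-first (suc k) f = trans (count-∑ (first (suc k) f))
  (cong suc (trans (sym (count-∑ (first k f))) (count-first k f)))

addVertex : ∀ {n} → Graph n → (Fin n → Bool) → Graph (suc n)
addVertex G f .adj fzero    fzero    = false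
addVertex G f .adj fzero    (fsuc j) = f j
addVertex G f .adj (fsuc i) fzero    = f i
addVertex G f .adj (fsuc i) (fsuc j) = adj G i j
addVertex G f .adj-sym fzero    fzero    = refl
addVertex G f .adj-sym fzero    (fsuc j) = refl
addVertex G f .adj-sym (fsuc i) fzero    = refl
addVertex G f .adj-sym (fsuc i) (fsuc j) = adj-sym G i j
addVertex G f .adj-irrefl fzero    = refl
addVertex G f .adj-irrefl (fsuc i) = adj-irrefl G i

-- The new vertex has index 0, so its edges are all counted in row 0, while column 0 vanishes by
-- computation.
size-addVertex : ∀ {n} (G : Graph n) f → size (addVertex G f) ≡ count f + size G
size-addVertex G f = trans (size-∑ (addVertex G f)) (cong₂ _+_ (sym (count-∑ f)) (sym (size-∑ G)))

-- Prepends a K4 on the vertices 0, 1, 2, 3; vertex 1 is joined to α and vertex 0 to β.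
addK4 : ∀ {n} → Graph n → (α β : Fin n → Bool) → Graph (4 + n)
addK4 G α β = addVertex (addVertex (addVertex (addVertex G none) (first 1 none)) (first 2 α)) (first 3 β)

size-addK4 : ∀ {n} (G : Graph n) α β → size (addK4 G α β) ≡ 6 + (count α + count β) + size G
size-addK4 {n} G α β = begin
  size (addK4 G α β)
    ≡⟨ size-addVertex _ (first 3 β) ⟩
  count (first 3 β) + size (addVertex (addVertex (addVertex G none) (first 1 none)) (first 2 α))
    ≡⟨ cong₂ _+_ (count-first 3 β) (size-addVertex _ (first 2 α)) ⟩
  3 + count β + (count (first 2 α) + size (addVertex (addVertex G none) (first 1 none)))
    ≡⟨ cong (3 + count β +_) (cong₂ _+_ (count-first 2 α) (size-addVertex (addVertex G none) (first 1 none))) ⟩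
  3 + count β + (2 + count α + (count (first 1 (none {n})) + size (addVertex G none)))
    ≡⟨ cong (λ m → 3 + count β + (2 + count α + m)) (cong₂ _+_
         (trans (count-first 1 (none {n})) (cong suc count-none))
         (trans (size-addVertex G none) (cong (_+ size G) count-none))) ⟩
  3 + count β + (2 + count α + (1 + size G))
    ≡⟨ collect (count α) (count β) (size G) ⟩
  6 + (count α + count β) + size G ∎
  where
  open ≡-Reasoning
  collect : ∀ a b s → 3 + b + (2 + a + (1 + s)) ≡ 6 + (a + b) + s
  collect = solve-∀

edge≢ : ∀ {n} (G : Graph n) {u v} → Edge G u v → u ≢ v
edge≢ G {u} e refl with trans (sym e) (adj-irrefl G u)
... | ()

triangle : ∀ {n} (G : Graph n) v {a b c} → Edge G v a → Edge G v b → Edge G v c →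
           Edge G a b → Edge G b c → Edge G c a → LocalCycle G v
triangle {n} G v {a} {b} {c} va vb vc ab bc ca = 0 , lookup abc , inj , hub , path , ca
  where
  abc = a ∷ b ∷ c ∷ []
  inj : ∀ {i j} → lookup abc i ≡ lookup abc j → i ≡ j
  inj {fzero}             {fzero}             _  = refl
  inj {fzero}             {fsuc fzero}        eq = contradiction eq (edge≢ G ab)
  inj {fzero}             {fsuc (fsuc fzero)} eq = contradiction (sym eq) (edge≢ G ca)
  inj {fsuc fzero}        {fzero}             eq = contradiction (sym eq) (edge≢ G ab)
  inj {fsuc fzero}        {fsuc fzero}        _  = refl
  inj {fsuc fzero}        {fsuc (fsuc fzero)} eq = contradiction eq (edge≢ G bc)
  inj {fsuc (fsuc fzero)} {fzero}             eq = contradiction eq (edge≢ G ca)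
  inj {fsuc (fsuc fzero)} {fsuc fzero}        eq = contradiction (sym eq) (edge≢ G bc)
  inj {fsuc (fsuc fzero)} {fsuc (fsuc fzero)} _  = refl
  hub : ∀ i → Edge G v (lookup abc i)
  hub fzero               = va
  hub (fsuc fzero)        = vb
  hub (fsuc (fsuc fzero)) = vc
  path : ∀ i → Edge G (lookup abc (inject₁ i)) (lookup abc (fsuc i))
  path fzero        = ab
  path (fsuc fzero) = bc

-- Walks, open chains and the attachment of a K4.

module _ {n : ℕ} {G : Graph n} {P : Fin n → Set} where

  start : ∀ {u v} → Walk G P u v → P u
  start (here p)     = p
  start (step p _ _) = p

  infixr 5 _⁀_
  _⁀_ : ∀ {u v w} → Walk G P u v → Walk G P v w → Walk G P u w
  here _     ⁀ w′ = w′
  step p e w ⁀ w′ = step p e (w ⁀ w′)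

  reverse : ∀ {u v} → Walk G P u v → Walk G P v u
  reverse (here p)                 = here p
  reverse (step {u} {v} p e w) = reverse w ⁀ step (start w) (trans (adj-sym G v u) e) (here p)

mapWalk : ∀ {n m} {G : Graph n} {H : Graph m} {P Q} (f : Fin n → Fin m) →
          (∀ {u v} → Edge G u v → Edge H (f u) (f v)) → (∀ {u} → P u → Q (f u)) →
          ∀ {u v} → Walk G P u v → Walk H Q (f u) (f v)
mapWalk f fe fp (here p)     = here (fp p)
mapWalk f fe fp (step p e w) = step (fp p) (fe e) (mapWalk f fe fp w)

-- The last condition says that adding an edge ab makes G 2-connected.
record OpenChain {n} (G : Graph n) (a b : Fin n) : Set where
  field
    nonforesty : LocallyNonforesty G
    toEnd      : ∀ u → Walk G (λ _ → ⊤) u b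
    toSomeEnd  : ∀ x u → u ≢ x → Walk G (_≢ x) u a ⊎ Walk G (_≢ x) u b

-- The new K4 is joined by its vertex 1 to the end `a`, and its vertex 0 replaces `a` as an end.
-- Taking `none` for `β` lengthens the chain; taking `only b` closes it to a ring.
module Extension {n : ℕ} {G : Graph n} {a b : Fin n} (chain : OpenChain G a b) (β : Fin n → Bool) where
  open OpenChain chain

  E : Graph (4 + n)
  E = addK4 G (only a) β

  new : Fin 4 → Fin (4 + n)
  new i = i ↑ˡ n

  old : Fin n → Fin (4 + n)
  old = 4 ↑ʳ_

  data View : Fin (4 + n) → Set where
    isNew : ∀ i → View (new i)
    isOld : ∀ v → View (old v)

  view : ∀ v → View v
  view fzero                             = isNew fzero
  view (fsuc fzero)                      = isNew (fsuc fzero)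
  view (fsuc (fsuc fzero))               = isNew (fsuc (fsuc fzero))
  view (fsuc (fsuc (fsuc fzero)))        = isNew (fsuc (fsuc (fsuc fzero)))
  view (fsuc (fsuc (fsuc (fsuc v))))     = isOld v

  i₀ i₁ : Fin 4
  i₀ = fzero
  i₁ = fsuc fzero

  new≢old : ∀ i {v} → new i ≢ old v
  new≢old fzero                      ()
  new≢old (fsuc fzero)               ()
  new≢old (fsuc (fsuc fzero))        ()
  new≢old (fsuc (fsuc (fsuc fzero))) ()

  old-injective : ∀ {u v} → old u ≡ old v → u ≡ v
  old-injective refl = refl

  new-edge : ∀ i j → i ≢ j → Edge E (new i) (new j)
  new-edge fzero fzero i≢j = contradiction refl i≢j
  new-edge fzero (fsuc fzero) _ = refl
  new-edge fzero (fsuc (fsuc fzero)) _ = refl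
  new-edge fzero (fsuc (fsuc (fsuc fzero))) _ = refl
  new-edge (fsuc fzero) fzero _ = refl
  new-edge (fsuc fzero) (fsuc fzero) i≢j = contradiction refl i≢j
  new-edge (fsuc fzero) (fsuc (fsuc fzero)) _ = refl
  new-edge (fsuc fzero) (fsuc (fsuc (fsuc fzero))) _ = refl
  new-edge (fsuc (fsuc fzero)) fzero _ = refl
  new-edge (fsuc (fsuc fzero)) (fsuc fzero) _ = refl
  new-edge (fsuc (fsuc fzero)) (fsuc (fsuc fzero)) i≢j = contradiction refl i≢j
  new-edge (fsuc (fsuc fzero)) (fsuc (fsuc (fsuc fzero))) _ = refl
  new-edge (fsuc (fsuc (fsuc fzero))) fzero _ = refl
  new-edge (fsuc (fsuc (fsuc fzero))) (fsuc fzero) _ = refl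
  new-edge (fsuc (fsuc (fsuc fzero))) (fsuc (fsuc fzero)) _ = refl
  new-edge (fsuc (fsuc (fsuc fzero))) (fsuc (fsuc (fsuc fzero))) i≢j = contradiction refl i≢j

  within : ∀ {P} i j → P (new i) → P (new j) → Walk E P (new i) (new j)
  within {P} i j p q with i ≟ j
  ... | yes refl = here {P = P} p
  ... | no  i≢j  = step p (new-edge i j i≢j) (here q)

  lift : ∀ {P Q} → (∀ {u} → P u → Q (old u)) → ∀ {u v} → Walk G P u v → Walk E Q (old u) (old v)
  lift = mapWalk old id

  bridge : ∀ {P} → P (old a) → P (new i₁) → Walk E P (old a) (new i₁)
  bridge p q = step p (only-self a) (here q)

  newToEnd : ∀ {Q} i → Q (new i) → Q (new i₁) → (∀ {u} → Q (old u)) → Walk E Q (new i) (old b)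
  newToEnd i p q r = within i i₁ p q ⁀ reverse (bridge r q) ⁀ lift (λ _ → r) (toEnd a)

  avoid-old : ∀ {x u} → u ≢ x → old u ≢ old x
  avoid-old u≢x = u≢x ∘ old-injective

  toNew₀ : ∀ {x u} → Walk G (_≢ x) u a → Walk E (_≢ old x) (old u) (new i₀)
  toNew₀ w = lift avoid-old w ⁀ bridge (avoid-old (start (reverse w))) (new≢old i₁) ⁀
             within i₁ i₀ (new≢old i₁) (new≢old i₀)

  E-nonforesty : LocallyNonforesty E
  E-nonforesty v with view v
  ... | isOld u = let m , c , inj , rest = nonforesty u in m , old ∘ c , inj ∘ old-injective , rest
  ... | isNew fzero =
    triangle E (new fzero) {a = new i₁} {b = fsuc (fsuc fzero)} {c = fsuc (fsuc (fsuc fzero))} refl refl refl refl refl refl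
  ... | isNew (fsuc fzero) =
    triangle E (new (fsuc fzero)) {a = new i₀} {b = fsuc (fsuc fzero)} {c = fsuc (fsuc (fsuc fzero))} refl refl refl refl refl refl
  ... | isNew (fsuc (fsuc fzero)) =
    triangle E (new (fsuc (fsuc fzero))) {a = new i₀} {b = new i₁} {c = fsuc (fsuc (fsuc fzero))} refl refl refl refl refl refl
  ... | isNew (fsuc (fsuc (fsuc fzero))) =
    triangle E (new (fsuc (fsuc (fsuc fzero)))) {a = new i₀} {b = new i₁} {c = fsuc (fsuc fzero)} refl refl refl refl refl refl

  E-toEnd : ∀ u → Walk E (λ _ → ⊤) u (old b)
  E-toEnd u with view u
  ... | isOld v = lift id (toEnd v)
  ... | isNew i = newToEnd i tt tt tt

  -- If an old vertex is deleted, the new K4 is intact and walks to `a` continue to the new end. If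
  -- a new vertex is deleted, the old chain is intact and its vertices reach `b`. New vertices reach
  -- the new end unless that is the deleted one; then they reach `b` over the bridge.
  E-chain : OpenChain E (new i₀) (old b)
  E-chain .OpenChain.nonforesty = E-nonforesty
  E-chain .OpenChain.toEnd      = E-toEnd
  E-chain .OpenChain.toSomeEnd x u u≢x with view x | view u
  ... | isOld y | isNew i = inj₁ (within i i₀ u≢x (new≢old i₀))
  ... | isNew j | isOld v = inj₂ (lift (λ _ → new≢old j ∘ sym) (toEnd v))
  ... | isNew j | isNew i with j ≟ i₀
  ...   | yes refl = inj₂ (newToEnd i u≢x (λ ()) (λ ()))
  ...   | no  j≢i₀ = inj₁ (within i i₀ u≢x (j≢i₀ ∘ sym ∘ ↑ˡ-injective n i₀ j))
  E-chain .OpenChain.toSomeEnd x u u≢x | isOld y | isOld v with toSomeEnd y v (u≢x ∘ cong old)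
  ...   | inj₁ w = inj₁ (toNew₀ w)
  ...   | inj₂ w = inj₂ (lift avoid-old w)

  E-connected : Connected E
  E-connected u v = E-toEnd u ⁀ reverse (E-toEnd v)

  -- The edge between `b` and the new end turns "some end" into one common meeting point for all
  -- remaining vertices: the new end if an old vertex is deleted, `b` if a new one is.
  E-2-connected : β b ≡ true → TwoConnected E
  E-2-connected βb = m≤m+n 3 (suc n) , E-connected , E-noCut
    where
    link : ∀ {P} → P (old b) → P (new i₀) → Walk E P (old b) (new i₀)
    link p q = step p βb (here q)
    meet : ∀ x → ∃ λ r → ∀ u → u ≢ x → Walk E (_≢ x) u r
    meet x with view x
    ... | isOld y = new i₀ , λ u → go u (view u)
      where
      go : ∀ u → View u → u ≢ old y → Walk E (_≢ old y) u (new i₀)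
      go _ (isNew i) u≢x = within i i₀ u≢x (new≢old i₀)
      go _ (isOld v) u≢x with toSomeEnd y v (u≢x ∘ cong old)
      ... | inj₁ w = toNew₀ w
      ... | inj₂ w = lift avoid-old w ⁀ link (avoid-old (start (reverse w))) (new≢old i₀)
    ... | isNew j = old b , λ u → go u (view u)
      where
      go : ∀ u → View u → u ≢ new j → Walk E (_≢ new j) u (old b)
      go _ (isOld v) u≢x = lift (λ _ → new≢old j ∘ sym) (toEnd v)
      go _ (isNew i) u≢x with j ≟ i₀
      ... | yes refl = newToEnd i u≢x (λ ()) (λ ())
      ... | no  j≢i₀ = within i i₀ u≢x new₀≢ ⁀ reverse (link (new≢old j ∘ sym) new₀≢)
        where
        new₀≢ : new i₀ ≢ new j
        new₀≢ = j≢i₀ ∘ sym ∘ ↑ˡ-injective n i₀ j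
    E-noCut : ∀ x → ConnectedWithout E x
    E-noCut x u v u≢x v≢x = let _ , walk = meet x in walk u u≢x ⁀ reverse (walk v v≢x)

-- Verification of small blocks by evaluation.

module _ {n : ℕ} (G : Graph n) where

  edge? : ∀ u v → Dec (Edge G u v)
  edge? u v = adj G u v ≟ᵇ true

  -- A decidable substitute for walks inside `P` with at most two edges; the alternative `u ≡ m`
  -- covers a single edge.
  Near : (Fin n → Set) → Fin n → Fin n → Set
  Near P u w = P u × P w × (u ≡ w ⊎ ∃ λ m → P m × (Edge G u m × Edge G m w ⊎ u ≡ m × Edge G m w))

  near? : ∀ {P : Fin n → Set} → (∀ v → Dec (P v)) → ∀ u w → Dec (Near P u w)
  near? P? u w = P? u ×-dec P? w ×-dec ((u ≟ w) ⊎-dec any? λ m →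
                   P? m ×-dec ((edge? u m ×-dec edge? m w) ⊎-dec ((u ≟ m) ×-dec edge? m w)))

  near⇒walk : ∀ {P u w} → Near P u w → Walk G P u w
  near⇒walk (p , q , inj₁ refl)                          = here p
  near⇒walk (p , q , inj₂ (m , r , inj₁ (um , mw)))      = step p um (step r mw (here q))
  near⇒walk (p , q , inj₂ (m , r , inj₂ (refl , mw)))    = step p mw (here q)

  -- A decidable condition stronger than `OpenChain`: local cycles are triangles and walks have at
  -- most two edges.
  Block : Fin n → Fin n → Set
  Block a b =
    (∀ v → ∃ λ x → Edge G v x × ∃ λ y → Edge G v y × Edge G x y × ∃ λ z → Edge G v z × Edge G y z × Edge G z x) ×
    (∀ u → Near (λ _ → ⊤) u b) ×
    (∀ x u → u ≢ x → Near (_≢ x) u a ⊎ Near (_≢ x) u b)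

  block? : ∀ a b → Dec (Block a b)
  block? a b =
    all? (λ v → any? λ x → edge? v x ×-dec any? λ y → edge? v y ×-dec edge? x y ×-dec
                any? λ z → edge? v z ×-dec edge? y z ×-dec edge? z x)
    ×-dec all? (λ u → near? (λ _ → yes tt) u b)
    ×-dec all? (λ x → all? λ u → ¬? (u ≟ x) →-dec
                 (near? (λ v → ¬? (v ≟ x)) u a ⊎-dec near? (λ v → ¬? (v ≟ x)) u b))

  block⇒chain : ∀ {a b} → Block a b → OpenChain G a b
  block⇒chain (tri , end , some) .OpenChain.nonforesty v =
    let _ , vx , _ , vy , xy , _ , vz , yz , zx = tri v in triangle G v vx vy vz xy yz zx
  block⇒chain (tri , end , some) .OpenChain.toEnd u = near⇒walk (end u)
  block⇒chain (tri , end , some) .OpenChain.toSomeEnd x u u≢x =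
    Sum.map near⇒walk near⇒walk (some x u u≢x)

Chained : ℕ → ℕ → Set
Chained n s = Σ (Graph n) λ G → ∃ λ a → ∃ λ b → OpenChain G a b × size G ≡ s

empty : Graph 0
empty .adj ()
empty .adj-sym ()
empty .adj-irrefl ()

K4 : Graph 4
K4 = addK4 empty none none

-- K4, K5 minus an edge, two K4 sharing an edge, and two K4 sharing a vertex.
block : ∀ r → r < 4 → Chained (4 + r) (6 + surplus r)
block 0 _ = K4 , fzero , fsuc fzero , block⇒chain K4 (from-yes (block? K4 fzero (fsuc fzero))) , refl
block 1 _ = G , fzero , b , block⇒chain G (from-yes (block? G fzero b)) , refl
  where
  -- The ends 0 and 4 are the two non-adjacent vertices.
  G = addVertex K4 (lookup (true ∷ true ∷ true ∷ false ∷ []))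
  b = fsuc (fsuc (fsuc (fsuc fzero)))
block 2 _ = G , fzero , b , block⇒chain G (from-yes (block? G fzero b)) , refl
  where
  -- The two K4 occupy 0, 1, 2, 3 and 2, 3, 4, 5; the ends lie off the shared edge, one in each.
  G = addVertex (addVertex K4 (lookup (true ∷ true ∷ false ∷ false ∷ [])))
        (lookup (true ∷ true ∷ true ∷ false ∷ false ∷ []))
  b = fsuc (fsuc (fsuc (fsuc fzero)))
block 3 _ = G , fzero , b , block⇒chain G (from-yes (block? G fzero b)) , refl
  where
  -- The two K4 occupy 0, 1, 2, 3 and 3, 4, 5, 6, with the ends on either side of the shared vertex
  -- 3.
  G = addVertex (addVertex (addVertex K4 (lookup (true ∷ false ∷ false ∷ false ∷ [])))
        (lookup (true ∷ true ∷ false ∷ false ∷ false ∷ [])))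
        (lookup (true ∷ true ∷ true ∷ false ∷ false ∷ false ∷ []))
  b = fsuc (fsuc (fsuc (fsuc fzero)))
block (suc (suc (suc (suc _)))) (s≤s (s≤s (s≤s (s≤s ()))))

-- Each further K4 contributes four vertices and seven edges: its own six and one bridge.
grow : ∀ {n s} j → Chained n s → Chained (j * 4 + n) (j * 7 + s)
grow zero    c = c
grow (suc j) c with grow j c
... | G , a , b , chain , sz = E , new i₀ , old b , E-chain ,
      trans (size-addK4 G (only a) none)
            (cong₂ (λ α s → 6 + α + s) (cong₂ _+_ (count-only a) count-none) sz)
  where open Extension chain none

Extremal : ℕ → ℕ → Set
Extremal n s = Σ (Graph n) λ G → TwoConnected G × LocallyNonforesty G × size G ≡ s

-- The last K4 contributes its six edges and two links, one to either end of the chain.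
close : ∀ {n s} → Chained n s → Extremal (4 + n) (8 + s)
close (G , a , b , chain , sz) = E , E-2-connected (only-self b) , E-nonforesty ,
    trans (size-addK4 G (only a) (only b))
          (cong₂ (λ α s → 6 + α + s) (cong₂ _+_ (count-only a) (count-only b)) sz)
  where open Extension chain (only b)

-- With `q = n / 4 ≥ 2`, the ring consists of the block of order `4 + r`, of `q - 2` further K4, and
-- of the closing K4.
extremal : ∀ n → 8 ≤ n → Extremal n (g n)
extremal n 8≤n = by-quotient (n / 4) (/-monoˡ-≤ 4 8≤n) (m≡m%n+[m/n]*n n 4) (g-value n)
  where
  r : ℕ
  r = n % 4
  order : ∀ j r → 4 + (j * 4 + (4 + r)) ≡ r + (2 + j) * 4
  order = solve-∀
  edges : ∀ j s → 8 + (j * 7 + (6 + s)) ≡ s + 7 * (2 + j)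
  edges = solve-∀
  by-quotient : ∀ q → 2 ≤ q → n ≡ r + q * 4 → g n ≡ surplus r + 7 * q → Extremal n (g n)
  by-quotient (suc zero) (s≤s ())
  by-quotient (suc (suc j)) _ n≡ g≡ =
    subst₂ Extremal (trans (order j r) (sym n≡)) (trans (edges j (surplus r)) (sym g≡))
      (close (grow j (block r (m%n<n n 4))))

theorem3 : (n : ℕ) → 8 ≤ n →
    ((G : Graph n) → TwoConnected G → LocallyNonforesty G → g n ≤ size G)
    × (Σ (Graph n) λ G → TwoConnected G × LocallyNonforesty G × size G ≡ g n)
theorem3 n 8≤n = lower , extremal n 8≤n
  where
  lower : (G : Graph n) → TwoConnected G → LocallyNonforesty G → g n ≤ size G
  lower G (_ , connected , noCut) nonforesty = gap⇒size-bound n 8*size slack-gap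
    where open LowerBound G 8≤n connected noCut nonforesty
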